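{- Let $r\ge 2$, $n=2^r$, $M=2^{n-r}$, $\nu=2^{r-1}-1$. (1) If $\mathcal{C}$ is a zeroed NP1CC of length $n$ of Type A, or a zeroed NP1CC of length $n$ of Type C containing a codeword of weight one, then $A_0(\mathcal{C})=A_n(\mathcal{C})=1$; for other even $i$, $$A_i(\mathcal{C})=\alpha_i+\alpha_{i-1}=\frac{\binom{n}{i}+(n-1)(\Delta_{i-1}+\Delta_i)}{n};$$ and for odd $i$, $1\le i\le n-1$, $A_i(\mathcal{C})=\frac1n\binom{n}{i}$. (2) If $\mathcal{C}$ is a non-zeroed NP1CC of length $n$ of Type A, or a non-zeroed NP1CC of length $n$ of Type B or Type C that contains exactly one codeword of weight one, then $A_0(\mathcal{C})=A_n(\mathcal{C})=0$; for even $i$ with $1<i<n-1$, $$A_i(\mathcal{C})=\beta_i+\beta_{i-1}=\frac{\binom{n}{i}-(\Delta_{i-1}+\Delta_i)}{n};$$ and for odd $i$, $1\le i\le n-1$, $A_i(\mathcal{C})=\frac1n\binom{n}{i}$.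
   Context: All codes are binary; $A_i(\mathcal{C})$ is the number of codewords of $\mathcal{C}$ of Hamming weight $i$. A code is zeroed if it contains the all-zero word, non-zeroed otherwise. An NP1CC (nearly perfect 1-covering code) of length $n=2^r$ is a code $\mathcal{C}\subseteq\mathbb{F}_2^n$ with $|\mathcal{C}|=2^{n-r}$ such that every word of $\mathbb{F}_2^n$ is at distance at most $1$ from some codeword. In an NP1CC every codeword $\mathbf{c}$ has exactly one other codeword $\mathbf{c}'$ (its partner) with $d(\mathbf{c},\mathbf{c}')\in\{1,2\}$. The NP1CC is of Type A if every codeword's partner is at distance $1$, of Type B if every codeword's partner is at distance $2$, and of Type C otherwise. For integers $i\ge0$: $\Delta_i=\binom{\nu}{\lfloor i/2\rfloor}$ if $i\equiv 0,3\pmod 4$, $\Delta_i=-\binom{\nu}{\lfloor i/2\rfloor}$ if $i\equiv 1,2\pmod 4$ (with $\binom{a}{b}=0$ for $b>a$); $\alpha_i=\frac{\binom{n-1}{i}+(n-1)\Delta_i}{n}$, $\beta_i=\frac{\binom{n-1}{i}-\Delta_i}{n}$. -}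

module Defs where

open import Data.Bool using (Bool; true; false; _xor_)
open import Data.Nat using (ℕ; zero; suc; _+_; _*_; _∸_; _^_; _≤_; _≟_)
open import Data.Nat.Properties using (m^n≢0)
open import Data.Nat.Combinatorics using (_C_)
open import Data.Integer as ℤ using (ℤ; +_; -_)
open import Data.Rational using (ℚ; _/_)
open import Data.Vec using (Vec; []; _∷_; zipWith; replicate)
open import Data.List using (List; length; filter)
open import Data.List.Membership.Propositional using (_∈_)
open import Data.List.Relation.Unary.Unique.Propositional using (Unique)
open import Data.Product using (_×_; ∃-syntax; Σ-syntax)
open import Relation.Nullary using (¬_)
open import Relation.Binary.PropositionalEquality using (_≡_)

Word : ℕ → Set
Word n = Vec Bool n

weight : ∀ {n} → Word n → ℕ
weight []          = 0
weight (true ∷ v)  = suc (weight v)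
weight (false ∷ v) = weight v

dist : ∀ {n} → Word n → Word n → ℕ
dist x y = weight (zipWith _xor_ x y)

-- A code is a duplicate-free list of words (a finite set of words)
Code : ℕ → Set
Code n = List (Word n)

A : ∀ {n} → ℕ → Code n → ℕ
A i C = length (filter (λ c → weight c ≟ i) C)

Zeroed : ∀ {n} → Code n → Set
Zeroed {n} C = replicate n false ∈ C

NP1CC : (r : ℕ) → Code (2 ^ r) → Set
NP1CC r C =
  Unique C ×
  length C ≡ 2 ^ (2 ^ r ∸ r) ×
  (∀ (x : Word (2 ^ r)) → ∃[ c ] (c ∈ C × dist x c ≤ 1))

TypeA : ∀ {n} → Code n → Set
TypeA C = ∀ c → c ∈ C → ∃[ c′ ] (c′ ∈ C × dist c c′ ≡ 1)

TypeB : ∀ {n} → Code n → Set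
TypeB C = ∀ c → c ∈ C → ∃[ c′ ] (c′ ∈ C × dist c c′ ≡ 2)

TypeC : ∀ {n} → Code n → Set
TypeC C = ¬ TypeA C × ¬ TypeB C

signΔ : ℕ → ℤ → ℤ
signΔ 0 z = z
signΔ 1 z = - z
signΔ 2 z = - z
signΔ 3 z = z
signΔ (suc (suc (suc (suc k)))) z = signΔ k z

half : ℕ → ℕ
half 0 = 0
half 1 = 0
half (suc (suc k)) = suc (half k)

-- Δ_i with parameter ν (binomial is 0 when ⌊i/2⌋ > ν, as for _C_)
Δ : (ν i : ℕ) → ℤ
Δ ν i = signΔ i (+ (ν C half i))

_/2^_ : ℤ → ℕ → ℚ
z /2^ r = _/_ z (2 ^ r) {{m^n≢0 2 r}}

ν : ℕ → ℕ
ν r = 2 ^ (r ∸ 1) ∸ 1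

α : (r i : ℕ) → ℚ
α r i = ((+ ((2 ^ r ∸ 1) C i)) ℤ.+ (+ (2 ^ r ∸ 1)) ℤ.* Δ (ν r) i) /2^ r

β : (r i : ℕ) → ℚ
β r i = ((+ ((2 ^ r ∸ 1) C i)) ℤ.- Δ (ν r) i) /2^ r

{-# OPTIONS --safe #-}
-- For the indicator function f of the code, let S k f x be the sum of f over the words at distance k
-- from x, and let u = f + S 1 f count the codewords covering a word, so u ≥ 1. As n is even, the sum
-- of u over the ball around a word outside the code is even and exceeds n, so it is at least n + 2.
-- Summed over all words, this bound and (u - 1)(u - 2) ≥ 0 become an equality for a code of size
-- 2^n / n; hence both are equalities everywhere. Together with 3 ∤ n² this forces
-- S 1 f + S 2 f = 1 on the code, and the two cases combine into S 1 (S 1 f) + 2 S 1 f = n + 2 at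
-- every word.
--
-- Summing over the words of weight i turns S 1 into a three-term recurrence, so the weight sums of
-- S 1 f are determined by the one at weight 0, which is A 1 = 1; hence the i-th one is n C i, and
-- n C (i + 1) = (n - i) A i + (i + 2) A (i + 2), which leaves A 0 as the only parameter. The deviation
-- of n A i from n C i solves the homogeneous recurrence and is (n A 0 - 1) times the coefficient of
-- z^i in (1 - z²)^(n/2), that is Δ (i - 1) + Δ i.
module Submission where

open import Defs
open import Data.Bool as Bool using (true; false; not; if_then_else_)
open import Data.Bool.Properties using (xor-comm)
open import Data.Integer as ℤ using (ℤ; +_; -_; -1ℤ; 0ℤ; 1ℤ)
import Data.Integer.Properties as ℤ
import Data.Integer.Tactic.RingSolver as ℤ-Solver
open import Data.List using ([]; _∷_; length)
open import Data.List.Membership.Propositional using (_∈_; _∉_)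
open import Data.List.Relation.Unary.All as All using ()
open import Data.List.Relation.Unary.AllPairs using ([]; _∷_)
open import Data.List.Relation.Unary.Any using (here; there)
open import Data.List.Relation.Unary.Unique.Propositional using (Unique)
open import Data.Nat
open import Data.Nat.Combinatorics using (_C_; nC1≡n; nCn≡1; nCk+nC[k+1]≡[n+1]C[k+1])
open import Data.Nat.Divisibility using (_∣_; divides; ∣⇒≤)
open import Data.Nat.Primality using (Prime; prime?; euclidsLemma)
open import Data.Nat.Properties
open import Data.Nat.Tactic.RingSolver using (solve-∀)
open import Data.Product using (_×_; _,_; ∃-syntax; proj₁; proj₂)
open import Data.Rational as ℚ using (toℚᵘ)
open import Data.Rational.Properties using (toℚᵘ-injective; toℚᵘ-fromℚᵘ; fromℚᵘ-cong; toℚᵘ-homo-+)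
open import Data.Rational.Unnormalised as ℚᵘ using (mkℚᵘ; *≡*)
import Data.Rational.Unnormalised.Properties as ℚᵘ
open import Data.Sum using (_⊎_; inj₁; inj₂)
open import Data.Vec using ([]; _∷_; replicate)
open import Data.Vec.Properties using (zipWith-comm; ≡-dec)
open import Function using (_∘_; const)
open import Relation.Binary.PropositionalEquality
open import Relation.Nullary using (¬_; contradiction; does; yes; no)
open import Relation.Nullary.Decidable using (from-yes)

private
  variable
    n : ℕ

-- Sums over spheres

-- Recursion on the first bit, flipped or kept, so that identities between sphere sums go by
-- induction on the length.
S : ℕ → (Word n → ℕ) → Word n → ℕ
S zero    g x       = g x
S (suc k) g []      = 0
S (suc k) g (b ∷ x) = S k (g ∘ (not b ∷_)) x + S (suc k) (g ∘ (b ∷_)) x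

private
  interchange : ∀ a b c d → (a + b) + (c + d) ≡ (a + c) + (b + d)
  interchange = solve-∀

  x+[y+z]≡y+[x+z] : ∀ a b c → a + (b + c) ≡ b + (a + c)
  x+[y+z]≡y+[x+z] = solve-∀

dist-refl : (x : Word n) → dist x x ≡ 0
dist-refl []          = refl
dist-refl (false ∷ x) = dist-refl x
dist-refl (true  ∷ x) = dist-refl x

dist≡0⇒≡ : (x y : Word n) → dist x y ≡ 0 → x ≡ y
dist≡0⇒≡ []          []          _ = refl
dist≡0⇒≡ (false ∷ x) (false ∷ y) e = cong (false ∷_) (dist≡0⇒≡ x y e)
dist≡0⇒≡ (true  ∷ x) (true  ∷ y) e = cong (true ∷_) (dist≡0⇒≡ x y e)

dist-zero : (x : Word n) → dist (replicate n false) x ≡ weight x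
dist-zero []          = refl
dist-zero (false ∷ x) = dist-zero x
dist-zero (true  ∷ x) = cong suc (dist-zero x)

-- The comparison is required on the sphere only: `near≢0` uses it, through `S-cong`, with a
-- function known only at the neighbours of `x`.
S-mono : ∀ k {g h : Word n → ℕ} x → (∀ y → dist x y ≡ k → g y ≤ h y) → S k g x ≤ S k h x
S-mono zero    x           e = e x (dist-refl x)
S-mono (suc k) []          e = ≤-refl
S-mono (suc k) (false ∷ x) e = +-mono-≤
  (S-mono k x λ y d → e (true ∷ y) (cong suc d))
  (S-mono (suc k) x λ y d → e (false ∷ y) d)
S-mono (suc k) (true ∷ x)  e = +-mono-≤
  (S-mono k x λ y d → e (false ∷ y) (cong suc d))
  (S-mono (suc k) x λ y d → e (true ∷ y) d)

S-cong : ∀ k {g h : Word n → ℕ} x → (∀ y → dist x y ≡ k → g y ≡ h y) → S k g x ≡ S k h x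
S-cong k x e = ≤-antisym
  (S-mono k x λ y d → ≤-reflexive (e y d)) (S-mono k x λ y d → ≤-reflexive (sym (e y d)))

S-≥ : ∀ k (g : Word n → ℕ) x y → dist x y ≡ k → g y ≤ S k g x
S-≥ zero    g x y d with refl ← dist≡0⇒≡ x y d = ≤-refl
S-≥ (suc k) g []          []          ()
S-≥ (suc k) g (false ∷ x) (false ∷ y) d =
  ≤-trans (S-≥ (suc k) (g ∘ (false ∷_)) x y d) (m≤n+m _ _)
S-≥ (suc k) g (true ∷ x)  (true ∷ y)  d =
  ≤-trans (S-≥ (suc k) (g ∘ (true ∷_)) x y d) (m≤n+m _ _)
S-≥ (suc k) g (false ∷ x) (true ∷ y)  d =
  ≤-trans (S-≥ k (g ∘ (true ∷_)) x y (suc-injective d)) (m≤m+n _ _)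
S-≥ (suc k) g (true ∷ x)  (false ∷ y) d =
  ≤-trans (S-≥ k (g ∘ (false ∷_)) x y (suc-injective d)) (m≤m+n _ _)

dist-sym : (x y : Word n) → dist x y ≡ dist y x
dist-sym x y = cong weight (zipWith-comm xor-comm x y)

-- Two neighbours of a word are equal or at distance 2.
S1≤S0+S2 : ∀ (g : Word n → ℕ) x y → dist x y ≡ 1 → S 1 g x ≤ g y + S 2 g y
S1≤S0+S2 g []          []          ()
S1≤S0+S2 g (false ∷ x) (false ∷ y) d = ≤-trans
  (+-mono-≤ (S-≥ 1 (g ∘ (true ∷_)) y x (trans (dist-sym y x) d)) (S1≤S0+S2 (g ∘ (false ∷_)) x y d))
  (≤-reflexive (x+[y+z]≡y+[x+z] (S 1 (g ∘ (true ∷_)) y) (g (false ∷ y)) _))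
S1≤S0+S2 g (true ∷ x)  (true ∷ y)  d = ≤-trans
  (+-mono-≤ (S-≥ 1 (g ∘ (false ∷_)) y x (trans (dist-sym y x) d)) (S1≤S0+S2 (g ∘ (true ∷_)) x y d))
  (≤-reflexive (x+[y+z]≡y+[x+z] (S 1 (g ∘ (false ∷_)) y) (g (true ∷ y)) _))
S1≤S0+S2 g (false ∷ x) (true ∷ y)  d with refl ← dist≡0⇒≡ x y (suc-injective d) =
  +-monoʳ-≤ (g (true ∷ x)) (m≤m+n _ _)
S1≤S0+S2 g (true ∷ x)  (false ∷ y) d with refl ← dist≡0⇒≡ x y (suc-injective d) =
  +-monoʳ-≤ (g (false ∷ x)) (m≤m+n _ _)

S-+ : ∀ k (g h : Word n → ℕ) x → S k (λ y → g y + h y) x ≡ S k g x + S k h x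
S-+ zero    g h x       = refl
S-+ (suc k) g h []      = refl
S-+ (suc k) g h (b ∷ x) = trans
  (cong₂ _+_ (S-+ k (g ∘ (not b ∷_)) _ x) (S-+ (suc k) (g ∘ (b ∷_)) _ x))
  (interchange (S k (g ∘ (not b ∷_)) x) _ _ _)

S-* : ∀ k m (g : Word n → ℕ) x → S k (λ y → m * g y) x ≡ m * S k g x
S-* zero    m g x       = refl
S-* (suc k) m g []      = sym (*-zeroʳ m)
S-* (suc k) m g (b ∷ x) = trans
  (cong₂ _+_ (S-* k m (g ∘ (not b ∷_)) x) (S-* (suc k) m (g ∘ (b ∷_)) x))
  (sym (*-distribˡ-+ m _ _))

S-1 : ∀ k (x : Word n) → S k (const 1) x ≡ n C k
S-1 zero    x       = refl
S-1 (suc k) []      = refl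
S-1 {suc n} (suc k) (b ∷ x) = trans (cong₂ _+_ (S-1 k x) (S-1 (suc k) x)) (nCk+nC[k+1]≡[n+1]C[k+1] n k)

S-0 : ∀ k (x : Word n) → S k (const 0) x ≡ 0
S-0 k x = S-* k 0 (const 0) x

S1-const : ∀ m (x : Word n) → S 1 (const m) x ≡ m * n
S1-const {n} m x = begin
  S 1 (const m) x            ≡⟨ S-cong 1 x (λ _ _ → sym (*-identityʳ m)) ⟩
  S 1 (λ y → m * 1) x        ≡⟨ S-* 1 m (const 1) x ⟩
  m * S 1 (const 1) x        ≡⟨ cong (m *_) (trans (S-1 1 x) (nC1≡n n)) ⟩
  m * n                      ∎
  where open ≡-Reasoning

module _ (p q : Word n → ℕ) (x : Word n) where

  -- Inductive step of `S-step`: `p` and `q` are the restrictions of the function to words whose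
  -- first bit agrees, respectively disagrees, with that of the centre. The case of radius 0 is
  -- separate because `S zero` does not split into two summands.
  S-step₀ : S 1 (S 1 p) x + 0 ≡ n * p x + 2 * S 2 p x →
    (p x + S 1 q x) + S 1 (λ y → q y + S 1 p y) x + 0 ≡ suc n * p x + 2 * (S 1 q x + S 2 p x)
  S-step₀ ih = begin
    (p x + S 1 q x) + S 1 (λ y → q y + S 1 p y) x + 0
      ≡⟨ cong (λ t → (p x + S 1 q x) + t + 0) (S-+ 1 q (S 1 p) x) ⟩
    (p x + S 1 q x) + (S 1 q x + S 1 (S 1 p) x) + 0
      ≡⟨ lhs (p x) (S 1 q x) (S 1 (S 1 p) x) ⟩
    p x + 2 * S 1 q x + (S 1 (S 1 p) x + 0)
      ≡⟨ cong (λ t → p x + 2 * S 1 q x + t) ih ⟩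
    p x + 2 * S 1 q x + (n * p x + 2 * S 2 p x)
      ≡⟨ rhs n (p x) (S 1 q x) (S 2 p x) ⟩
    suc n * p x + 2 * (S 1 q x + S 2 p x) ∎
    where
    open ≡-Reasoning
    lhs : ∀ a b c → (a + b) + (b + c) + 0 ≡ a + 2 * b + (c + 0)
    lhs = solve-∀
    rhs : ∀ n a b c → a + 2 * b + (n * a + 2 * c) ≡ suc n * a + 2 * (b + c)
    rhs = solve-∀

  S-step₊ : ∀ k →
    S (2 + k) (S 1 p) x + suc k * S (suc k) p x ≡ n * S (suc k) p x + (3 + k) * S (3 + k) p x →
    S (1 + k) (S 1 q) x + k * S k q x ≡ n * S k q x + (2 + k) * S (2 + k) q x →
    S (1 + k) (λ y → p y + S 1 q y) x + S (2 + k) (λ y → q y + S 1 p y) x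
      + suc k * (S k q x + S (1 + k) p x)
    ≡ suc n * (S k q x + S (1 + k) p x) + (3 + k) * (S (2 + k) q x + S (3 + k) p x)
  S-step₊ k ihp ihq = begin
    S (1 + k) (λ y → p y + S 1 q y) x + S (2 + k) (λ y → q y + S 1 p y) x + suc k * (S k q x + S (1 + k) p x)
      ≡⟨ cong (_+ suc k * (S k q x + S (1 + k) p x))
           (cong₂ _+_ (S-+ (1 + k) p (S 1 q) x) (S-+ (2 + k) q (S 1 p) x)) ⟩
    (S (1 + k) p x + S (1 + k) (S 1 q) x) + (S (2 + k) q x + S (2 + k) (S 1 p) x)
      + suc k * (S k q x + S (1 + k) p x)
      ≡⟨ lhs k (S (1 + k) p x) (S (1 + k) (S 1 q) x) (S (2 + k) q x) (S (2 + k) (S 1 p) x) (S k q x) ⟩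
    (S (1 + k) p x + S (2 + k) q x + S k q x)
      + ((S (2 + k) (S 1 p) x + suc k * S (suc k) p x) + (S (1 + k) (S 1 q) x + k * S k q x))
      ≡⟨ cong₂ (λ s t → (S (1 + k) p x + S (2 + k) q x + S k q x) + (s + t)) ihp ihq ⟩
    (S (1 + k) p x + S (2 + k) q x + S k q x)
      + ((n * S (suc k) p x + (3 + k) * S (3 + k) p x) + (n * S k q x + (2 + k) * S (2 + k) q x))
      ≡⟨ rhs n k (S (1 + k) p x) (S (2 + k) q x) (S k q x) (S (3 + k) p x) ⟩
    suc n * (S k q x + S (1 + k) p x) + (3 + k) * (S (2 + k) q x + S (3 + k) p x) ∎
    where
    open ≡-Reasoning
    lhs : ∀ k a b c d e → (a + b) + (c + d) + suc k * (e + a) ≡ (a + c + e) + ((d + suc k * a) + (b + k * e))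
    lhs = solve-∀
    rhs : ∀ n k a b c d → (a + b + c) + ((n * a + (3 + k) * d) + (n * c + (2 + k) * b))
        ≡ suc n * (c + a) + (3 + k) * (b + d)
    rhs = solve-∀

-- Double counting of edges of the cube: a word at distance `k` from `x` has `n - k` neighbours at
-- distance `k + 1`, and a word at distance `k + 2` has `k + 2` of them. The term with factor `k`
-- stands on the left to avoid subtraction.
S-step : ∀ k (g : Word n → ℕ) x →
  S (1 + k) (S 1 g) x + k * S k g x ≡ n * S k g x + (2 + k) * S (2 + k) g x
S-step zero    g []          = refl
S-step (suc k) g []          = refl
S-step zero    g (false ∷ x) = S-step₀ (g ∘ (false ∷_)) (g ∘ (true ∷_)) x (S-step 0 _ x)
S-step zero    g (true ∷ x)  = S-step₀ (g ∘ (true ∷_)) (g ∘ (false ∷_)) x (S-step 0 _ x)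
S-step (suc k) g (false ∷ x) =
  S-step₊ (g ∘ (false ∷_)) (g ∘ (true ∷_)) x k (S-step (suc k) _ x) (S-step k _ x)
S-step (suc k) g (true ∷ x)  =
  S-step₊ (g ∘ (true ∷_)) (g ∘ (false ∷_)) x k (S-step (suc k) _ x) (S-step k _ x)

-- Sums over all words

∑ : (Word n → ℕ) → ℕ
∑ {zero}  g = g []
∑ {suc n} g = ∑ (g ∘ (false ∷_)) + ∑ (g ∘ (true ∷_))

∑-mono : {g h : Word n → ℕ} → (∀ x → g x ≤ h x) → ∑ g ≤ ∑ h
∑-mono {zero}  le = le []
∑-mono {suc n} le = +-mono-≤ (∑-mono (le ∘ (false ∷_))) (∑-mono (le ∘ (true ∷_)))

∑-cong : {g h : Word n → ℕ} → (∀ x → g x ≡ h x) → ∑ g ≡ ∑ h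
∑-cong e = ≤-antisym (∑-mono (≤-reflexive ∘ e)) (∑-mono (≤-reflexive ∘ sym ∘ e))

∑-+ : (g h : Word n → ℕ) → ∑ (λ x → g x + h x) ≡ ∑ g + ∑ h
∑-+ {zero}  g h = refl
∑-+ {suc n} g h = trans
  (cong₂ _+_ (∑-+ (g ∘ (false ∷_)) (h ∘ (false ∷_))) (∑-+ (g ∘ (true ∷_)) (h ∘ (true ∷_))))
  (interchange (∑ (g ∘ (false ∷_))) _ _ _)

∑-* : ∀ m (g : Word n → ℕ) → ∑ (λ x → m * g x) ≡ m * ∑ g
∑-* {zero}  m g = refl
∑-* {suc n} m g = trans
  (cong₂ _+_ (∑-* m (g ∘ (false ∷_))) (∑-* m (g ∘ (true ∷_))))
  (sym (*-distribˡ-+ m _ _))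

∑-const : ∀ n m → ∑ {n} (const m) ≡ m * 2 ^ n
∑-const zero    m = sym (*-identityʳ m)
∑-const (suc n) m = begin
  ∑ {n} (const m) + ∑ {n} (const m)  ≡⟨ cong₂ _+_ (∑-const n m) (∑-const n m) ⟩
  m * 2 ^ n + m * 2 ^ n              ≡⟨ double m (2 ^ n) ⟩
  m * (2 * 2 ^ n)                    ∎
  where
  open ≡-Reasoning
  double : ∀ a b → a * b + a * b ≡ a * (2 * b)
  double = solve-∀

-- Neither half of the cube can compensate for slack in the other, so the reversed inequality of
-- totals passes to each half and finally to each word.
∑-mono-≡ : {g h : Word n → ℕ} → (∀ x → g x ≤ h x) → ∑ h ≤ ∑ g → ∀ x → g x ≡ h x
∑-mono-≡ {zero}  le s [] = ≤-antisym (le []) s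
∑-mono-≡ {suc n} {g} {h} le s (b ∷ x) = go b
  where
  Σh≤Σg : ∀ b → ∑ (h ∘ (b ∷_)) ≤ ∑ (g ∘ (b ∷_))
  Σh≤Σg false = +-cancelʳ-≤ (∑ (h ∘ (true ∷_))) _ _
    (≤-trans s (+-monoʳ-≤ (∑ (g ∘ (false ∷_))) (∑-mono (le ∘ (true ∷_)))))
  Σh≤Σg true  = +-cancelˡ-≤ (∑ (h ∘ (false ∷_))) _ _
    (≤-trans s (+-monoˡ-≤ (∑ (g ∘ (true ∷_))) (∑-mono (le ∘ (false ∷_)))))
  go : ∀ b → g (b ∷ x) ≡ h (b ∷ x)
  go b = ∑-mono-≡ {g = g ∘ (b ∷_)} {h ∘ (b ∷_)} (λ y → le (b ∷ y)) (Σh≤Σg b) x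

-- Being at distance 1 is a symmetric relation, so the adjacency matrix of the cube is symmetric.
S1-self-adjoint : (g h : Word n → ℕ) → ∑ (λ x → S 1 g x * h x) ≡ ∑ (λ x → g x * S 1 h x)
S1-self-adjoint {zero}  g h = sym (*-zeroʳ (g []))
S1-self-adjoint {suc n} g h = begin
  ∑ (λ x → (g₁ x + S 1 g₀ x) * h₀ x) + ∑ (λ x → (g₀ x + S 1 g₁ x) * h₁ x)
    ≡⟨ cong₂ _+_ (splitˡ g₁ g₀ h₀) (splitˡ g₀ g₁ h₁) ⟩
  (∑ (λ x → g₁ x * h₀ x) + ∑ (λ x → S 1 g₀ x * h₀ x)) + (∑ (λ x → g₀ x * h₁ x) + ∑ (λ x → S 1 g₁ x * h₁ x))
    ≡⟨ cong₂ (λ s t → (∑ (λ x → g₁ x * h₀ x) + s) + (∑ (λ x → g₀ x * h₁ x) + t))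
         (S1-self-adjoint g₀ h₀) (S1-self-adjoint g₁ h₁) ⟩
  (∑ (λ x → g₁ x * h₀ x) + ∑ (λ x → g₀ x * S 1 h₀ x)) + (∑ (λ x → g₀ x * h₁ x) + ∑ (λ x → g₁ x * S 1 h₁ x))
    ≡⟨ swap (∑ (λ x → g₁ x * h₀ x)) (∑ (λ x → g₀ x * S 1 h₀ x))
         (∑ (λ x → g₀ x * h₁ x)) (∑ (λ x → g₁ x * S 1 h₁ x)) ⟩
  (∑ (λ x → g₀ x * h₁ x) + ∑ (λ x → g₀ x * S 1 h₀ x)) + (∑ (λ x → g₁ x * h₀ x) + ∑ (λ x → g₁ x * S 1 h₁ x))
    ≡⟨ sym (cong₂ _+_ (splitʳ g₀ h₁ h₀) (splitʳ g₁ h₀ h₁)) ⟩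
  ∑ (λ x → g₀ x * (h₁ x + S 1 h₀ x)) + ∑ (λ x → g₁ x * (h₀ x + S 1 h₁ x)) ∎
  where
  open ≡-Reasoning
  g₀ g₁ h₀ h₁ : Word n → ℕ
  g₀ = g ∘ (false ∷_)
  g₁ = g ∘ (true ∷_)
  h₀ = h ∘ (false ∷_)
  h₁ = h ∘ (true ∷_)
  swap : ∀ a b c d → (a + b) + (c + d) ≡ (c + b) + (a + d)
  swap = solve-∀
  splitˡ : ∀ (a b c : Word n → ℕ) → ∑ (λ x → (a x + S 1 b x) * c x) ≡ ∑ (λ x → a x * c x) + ∑ {n} (λ x → S 1 b x * c x)
  splitˡ a b c = trans (∑-cong λ x → *-distribʳ-+ (c x) (a x) (S 1 b x)) (∑-+ (λ x → a x * c x) (λ x → S 1 b x * c x))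
  splitʳ : ∀ (a b c : Word n → ℕ) → ∑ (λ x → a x * (b x + S 1 c x)) ≡ ∑ (λ x → a x * b x) + ∑ {n} (λ x → a x * S 1 c x)
  splitʳ a b c = trans (∑-cong λ x → *-distribˡ-+ (a x) (b x) (S 1 c x)) (∑-+ (λ x → a x * b x) (λ x → a x * S 1 c x))

-- Self-adjointness against the constant 1: each value is counted once for each of `n` neighbours.
∑-S1 : (g : Word n → ℕ) → ∑ (S 1 g) ≡ n * ∑ g
∑-S1 {n} g = begin
  ∑ (S 1 g)                      ≡⟨ ∑-cong (λ x → sym (*-identityʳ (S 1 g x))) ⟩
  ∑ (λ x → S 1 g x * 1)          ≡⟨ S1-self-adjoint g (const 1) ⟩
  ∑ (λ x → g x * S 1 (const 1) x)
    ≡⟨ ∑-cong (λ x → trans (cong (g x *_) (trans (S1-const 1 x) (*-identityˡ n))) (*-comm (g x) n)) ⟩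
  ∑ (λ x → n * g x)              ≡⟨ ∑-* n g ⟩
  n * ∑ g                        ∎
  where open ≡-Reasoning

-- Multiplicity functions of codes

δ : Word n → Word n → ℕ
δ []          []          = 1
δ (true  ∷ c) (true  ∷ x) = δ c x
δ (false ∷ c) (false ∷ x) = δ c x
δ (true  ∷ c) (false ∷ x) = 0
δ (false ∷ c) (true  ∷ x) = 0

δ-refl : (c : Word n) → δ c c ≡ 1
δ-refl []          = refl
δ-refl (true  ∷ c) = δ-refl c
δ-refl (false ∷ c) = δ-refl c

δ-≢ : (c x : Word n) → c ≢ x → δ c x ≡ 0
δ-≢ []          []          c≢x = contradiction refl c≢x
δ-≢ (true  ∷ c) (true  ∷ x) c≢x = δ-≢ c x (c≢x ∘ cong (true ∷_))
δ-≢ (false ∷ c) (false ∷ x) c≢x = δ-≢ c x (c≢x ∘ cong (false ∷_))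
δ-≢ (true  ∷ c) (false ∷ x) _   = refl
δ-≢ (false ∷ c) (true  ∷ x) _   = refl

∑-δ : (c : Word n) → ∑ (δ c) ≡ 1
∑-δ []                  = refl
∑-δ {suc n} (true  ∷ c) = cong₂ _+_ (∑-const n 0) (∑-δ c)
∑-δ {suc n} (false ∷ c) = cong₂ _+_ (∑-δ c) (∑-const n 0)

S-δ : ∀ i (c : Word n) → S i (δ c) (replicate n false) ≡ (if does (weight c ≟ i) then 1 else 0)
S-δ zero    []          = refl
S-δ (suc i) []          = refl
S-δ zero    (true  ∷ c) = refl
S-δ zero    (false ∷ c) = S-δ zero c
S-δ {suc n} (suc i) (true  ∷ c) =
  trans (cong₂ _+_ (S-δ i c) (S-0 (suc i) (replicate n false))) (+-identityʳ _)
S-δ {suc n} (suc i) (false ∷ c) = cong₂ _+_ (S-0 i (replicate n false)) (S-δ (suc i) c)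

mult : Code n → Word n → ℕ
mult []      x = 0
mult (c ∷ 𝒞) x = δ c x + mult 𝒞 x

-- Weight is distance from the zero word; this turns weight counts into sphere sums, to which
-- `S-step` applies.
A≡S-mult : ∀ i (𝒞 : Code n) → A i 𝒞 ≡ S i (mult 𝒞) (replicate n false)
A≡S-mult {n} i []      = sym (S-0 i (replicate n false))
A≡S-mult {n} i (c ∷ 𝒞)
  rewrite S-+ i (δ c) (mult 𝒞) (replicate n false) | S-δ i c | sym (A≡S-mult i 𝒞)
  with does (weight c ≟ i)
... | true  = refl
... | false = refl

∑-mult : (𝒞 : Code n) → ∑ (mult 𝒞) ≡ length 𝒞
∑-mult {n} []  = ∑-const n 0
∑-mult (c ∷ 𝒞) = trans (∑-+ (δ c) (mult 𝒞)) (cong₂ _+_ (∑-δ c) (∑-mult 𝒞))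

∈⇒1≤mult : {𝒞 : Code n} {x : Word n} → x ∈ 𝒞 → 1 ≤ mult 𝒞 x
∈⇒1≤mult {x = x} (here refl) = ≤-trans (≤-reflexive (sym (δ-refl x))) (m≤m+n _ _)
∈⇒1≤mult         (there x∈𝒞) = ≤-trans (∈⇒1≤mult x∈𝒞) (m≤n+m _ _)

∉⇒mult≡0 : (𝒞 : Code n) {x : Word n} → x ∉ 𝒞 → mult 𝒞 x ≡ 0
∉⇒mult≡0 []      x∉𝒞 = refl
∉⇒mult≡0 (c ∷ 𝒞) x∉𝒞 =
  cong₂ _+_ (δ-≢ c _ (λ c≡x → x∉𝒞 (here (sym c≡x)))) (∉⇒mult≡0 𝒞 (x∉𝒞 ∘ there))

mult≤1 : {𝒞 : Code n} → Unique 𝒞 → ∀ x → mult 𝒞 x ≤ 1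
mult≤1 []                     x = z≤n
mult≤1 {𝒞 = c ∷ 𝒞} (c∉𝒞 ∷ u) x with ≡-dec Bool._≟_ c x
... | yes refl = ≤-reflexive (cong₂ _+_ (δ-refl c) (∉⇒mult≡0 𝒞 λ c∈𝒞 → All.lookup c∉𝒞 c∈𝒞 refl))
... | no  c≢x  = ≤-trans (≤-reflexive (cong (_+ mult 𝒞 x) (δ-≢ c x c≢x))) (mult≤1 u x)

-- Local structure

private
  +-≡-split : ∀ {a b c d} → a ≤ b → c ≤ d → a + c ≡ b + d → a ≡ b × c ≡ d
  +-≡-split {a} {b} {c} {d} a≤b c≤d e = a≡b , +-cancelˡ-≡ a c d (trans e (cong (_+ d) (sym a≡b)))
    where
    a≡b : a ≡ b
    a≡b = ≤-antisym a≤b (+-cancelʳ-≤ d b a (≤-trans (≤-reflexive (sym e)) (+-monoʳ-≤ a c≤d)))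

  -- (m - 1) (m - 2) ≥ 0, as an inequality without subtraction
  3m≤m²+2 : ∀ m → 3 * m ≤ m * m + 2
  3m≤m²+2 0             = z≤n
  3m≤m²+2 1             = ≤-refl
  3m≤m²+2 (suc (suc m)) = ≤-trans (m≤m+n _ (m * m + m)) (≤-reflexive (eq m))
    where
    eq : ∀ m → 3 * suc (suc m) + (m * m + m) ≡ suc (suc m) * suc (suc m) + 2
    eq = solve-∀

  -- This is `(s - a)(1 - φ) ≥ 0` with the negative terms moved across.
  crossed : ∀ a s {φ} → φ ≡ 0 ⊎ φ ≡ 1 → (φ ≡ 0 → a ≤ s) → a + s * φ ≤ s + a * φ
  crossed a s (inj₁ refl) a≤s = subst₂ _≤_ (eq a s) (eq s a) (a≤s refl)
    where
    eq : ∀ a s → a ≡ a + s * 0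
    eq = solve-∀
  crossed a s (inj₂ refl) _   = ≤-reflexive (eq a s)
    where
    eq : ∀ a s → a + s * 1 ≡ s + a * 1
    eq = solve-∀

  ≤1-cases : ∀ {m} → m ≤ 1 → m ≡ 0 ⊎ m ≡ 1
  ≤1-cases z≤n       = inj₁ refl
  ≤1-cases (s≤s z≤n) = inj₂ refl

module NearlyPerfect {n} (f : Word n → ℕ) (h : ℕ) (n≡2h : n ≡ 2 * h)
  (f≤1 : ∀ x → f x ≤ 1)
  (cover : ∀ x → 1 ≤ f x + S 1 f x)
  (size : 2 ^ n ≡ n * ∑ f)
  (6∤n² : ∀ d → 6 * d ≢ n * n) where

  u Su : Word n → ℕ
  u x  = f x + S 1 f x
  Su x = u x + S 1 u x

  S1S1f : ∀ x → S 1 (S 1 f) x ≡ n * f x + 2 * S 2 f x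
  S1S1f x = trans (sym (+-identityʳ _)) (S-step 0 f x)

  -- The ball around `x` meets the ball around a codeword `c` in `n + 1` words if `c` is `x`, in two
  -- words if `c` is at distance 1 or 2, and otherwise in none.
  Su-expand : ∀ x → Su x ≡ suc n * f x + 2 * (S 1 f x + S 2 f x)
  Su-expand x = begin
    u x + S 1 u x
      ≡⟨ cong (λ t → u x + t) (S-+ 1 f (S 1 f) x) ⟩
    f x + S 1 f x + (S 1 f x + S 1 (S 1 f) x)
      ≡⟨ cong (λ t → f x + S 1 f x + (S 1 f x + t)) (S1S1f x) ⟩
    f x + S 1 f x + (S 1 f x + (n * f x + 2 * S 2 f x))
      ≡⟨ eq n (f x) (S 1 f x) (S 2 f x) ⟩
    suc n * f x + 2 * (S 1 f x + S 2 f x) ∎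
    where
    open ≡-Reasoning
    eq : ∀ n a b c → a + b + (b + (n * a + 2 * c)) ≡ suc n * a + 2 * (b + c)
    eq = solve-∀

  n<Su : ∀ x → n < Su x
  n<Su x = +-mono-≤ (cover x) (≤-trans
    (≤-reflexive (sym (trans (S1-const 1 x) (*-identityˡ n)))) (S-mono 1 x λ y _ → cover y))

  Su-even : ∀ x → f x ≡ 0 → Su x ≡ 2 * (S 1 f x + S 2 f x)
  Su-even x fx≡0 = trans (Su-expand x)
    (cong (_+ 2 * (S 1 f x + S 2 f x)) (trans (cong (suc n *_) fx≡0) (*-zeroʳ (suc n))))

  n+2≤Su : ∀ x → f x ≡ 0 → n + 2 ≤ Su x
  n+2≤Su x fx≡0 = begin
    n + 2                     ≡⟨ cong (_+ 2) n≡2h ⟩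
    2 * h + 2                 ≡⟨ eq h ⟩
    2 * suc h                 ≤⟨ *-monoʳ-≤ 2 (*-cancelˡ-< 2 h (S 1 f x + S 2 f x) 2h<) ⟩
    2 * (S 1 f x + S 2 f x)   ≡⟨ sym (Su-even x fx≡0) ⟩
    Su x                      ∎
    where
    open ≤-Reasoning
    eq : ∀ h → 2 * h + 2 ≡ 2 * suc h
    eq = solve-∀
    2h< : 2 * h < 2 * (S 1 f x + S 2 f x)
    2h< = subst₂ _<_ n≡2h (Su-even x fx≡0) (n<Su x)

  -- The difference `upper x - lower x` is `(Su x - (n + 2))(1 - f x)`: the excess over `n + 2` off
  -- the code, and zero on it.
  lower upper : Word n → ℕ
  lower x = (n + 2) + Su x * f x
  upper x = Su x + (n + 2) * f x

  lower≤upper : ∀ x → lower x ≤ upper x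
  lower≤upper x = crossed (n + 2) (Su x) (≤1-cases (f≤1 x)) (n+2≤Su x)

  ∑u : ∑ u ≡ suc n * ∑ f
  ∑u = trans (∑-+ f (S 1 f)) (cong (λ t → ∑ f + t) (∑-S1 f))

  ∑Su : ∑ Su ≡ suc n * (suc n * ∑ f)
  ∑Su = trans (∑-+ u (S 1 u)) (trans (cong (λ t → ∑ u + t) (∑-S1 u)) (cong (suc n *_) ∑u))

  -- Both `u` and `Su` arise by applying the identity plus `S 1`, a self-adjoint operator, so one
  -- application moves from `Su` onto `f`.
  ∑Su*f : ∑ (λ x → Su x * f x) ≡ ∑ (λ x → u x * u x)
  ∑Su*f = begin
    ∑ (λ x → (u x + S 1 u x) * f x)
      ≡⟨ ∑-cong (λ x → *-distribʳ-+ (f x) (u x) (S 1 u x)) ⟩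
    ∑ (λ x → u x * f x + S 1 u x * f x)
      ≡⟨ ∑-+ (λ x → u x * f x) (λ x → S 1 u x * f x) ⟩
    ∑ (λ x → u x * f x) + ∑ (λ x → S 1 u x * f x)
      ≡⟨ cong (λ t → ∑ (λ x → u x * f x) + t) (S1-self-adjoint u f) ⟩
    ∑ (λ x → u x * f x) + ∑ (λ x → u x * S 1 f x)
      ≡⟨ sym (∑-+ (λ x → u x * f x) (λ x → u x * S 1 f x)) ⟩
    ∑ (λ x → u x * f x + u x * S 1 f x)
      ≡⟨ ∑-cong (λ x → sym (*-distribˡ-+ (u x) (f x) (S 1 f x))) ⟩
    ∑ (λ x → u x * u x) ∎
    where open ≡-Reasoning

  F Q : ℕ
  F = ∑ f
  Q = ∑ (λ x → u x * u x)

  ∑lower : ∑ lower ≡ (n + 2) * (n * F) + Q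
  ∑lower = trans (∑-+ (const (n + 2)) (λ x → Su x * f x))
    (cong₂ _+_ (trans (∑-const n (n + 2)) (cong ((n + 2) *_) size)) ∑Su*f)

  ∑upper : ∑ upper ≡ suc n * (suc n * F) + (n + 2) * F
  ∑upper = trans (∑-+ Su (λ x → (n + 2) * f x)) (cong₂ _+_ ∑Su (∑-* (n + 2) f))

  ∑3u : ∑ (λ x → 3 * u x) ≡ 3 * (suc n * F)
  ∑3u = trans (∑-* 3 u) (cong (3 *_) ∑u)

  ∑u²+2 : ∑ (λ x → u x * u x + 2) ≡ Q + 2 * (n * F)
  ∑u²+2 = trans (∑-+ (λ x → u x * u x) (const 2))
    (cong (λ t → Q + t) (trans (∑-const n 2) (cong (2 *_) size)))

  -- The two pointwise inequalities add up to an equality of totals, so both are equalities.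
  tight : ∀ x → lower x ≡ upper x × 3 * u x ≡ u x * u x + 2
  tight x = +-≡-split (lower≤upper x) (3m≤m²+2 (u x))
    (∑-mono-≡ (λ y → +-mono-≤ (lower≤upper y) (3m≤m²+2 (u y))) (≤-reflexive totals) x)
    where
    open ≡-Reasoning
    -- On both sides `Q` occurs once and `F` has coefficient `n² + 5n + 3`, so the value of `Q` need
    -- not be known.
    eq : ∀ n F Q → (suc n * (suc n * F) + (n + 2) * F) + (Q + 2 * (n * F))
      ≡ ((n + 2) * (n * F) + Q) + 3 * (suc n * F)
    eq = solve-∀
    totals : ∑ (λ y → upper y + (u y * u y + 2)) ≡ ∑ (λ y → lower y + 3 * u y)
    totals = begin
      ∑ (λ y → upper y + (u y * u y + 2))
        ≡⟨ ∑-+ upper (λ y → u y * u y + 2) ⟩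
      ∑ upper + ∑ (λ y → u y * u y + 2)
        ≡⟨ cong₂ _+_ ∑upper ∑u²+2 ⟩
      (suc n * (suc n * F) + (n + 2) * F) + (Q + 2 * (n * F))
        ≡⟨ eq n F Q ⟩
      ((n + 2) * (n * F) + Q) + 3 * (suc n * F)
        ≡⟨ sym (cong₂ _+_ ∑lower ∑3u) ⟩
      ∑ lower + ∑ (λ y → 3 * u y)
        ≡⟨ sym (∑-+ lower (λ y → 3 * u y)) ⟩
      ∑ (λ y → lower y + 3 * u y) ∎

  -- On a codeword this counts the other codewords within distance 2, hence its partners.
  near : Word n → ℕ
  near x = S 1 f x + S 2 f x

  -- `S-step` at radius 0 rewrites the conclusion into the hypothesis, which can be checked
  -- separately on and off the code.
  spectral : ∀ m x → n * f x + 2 * near x ≡ m → S 1 (S 1 f) x + 2 * S 1 f x ≡ m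
  spectral m x e = begin
    S 1 (S 1 f) x + 2 * S 1 f x               ≡⟨ cong (_+ 2 * S 1 f x) (S1S1f x) ⟩
    n * f x + 2 * S 2 f x + 2 * S 1 f x       ≡⟨ eq (n * f x) (S 2 f x) (S 1 f x) ⟩
    n * f x + 2 * (S 1 f x + S 2 f x)         ≡⟨ e ⟩
    m                                         ∎
    where
    open ≡-Reasoning
    eq : ∀ a b c → a + 2 * b + 2 * c ≡ a + 2 * (c + b)
    eq = solve-∀

  -- Where `f x` vanishes, the first equality of `tight` reads `Su x = n + 2`, and `Su x` is
  -- `2 * near x`.
  off-code : ∀ x → f x ≡ 0 → S 1 (S 1 f) x + 2 * S 1 f x ≡ n + 2
  off-code x fx≡0 = spectral (n + 2) x (trans (cong (_+ 2 * near x)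
    (trans (cong (n *_) fx≡0) (*-zeroʳ n))) (trans (sym (Su-even x fx≡0)) (sym (begin
    n + 2                  ≡⟨ sym (+-identityʳ (n + 2)) ⟩
    n + 2 + 0              ≡⟨ cong (λ t → n + 2 + t) (sym (*-zeroʳ (Su x))) ⟩
    n + 2 + Su x * 0       ≡⟨ cong (λ t → n + 2 + Su x * t) (sym fx≡0) ⟩
    n + 2 + Su x * f x     ≡⟨ proj₁ (tight x) ⟩
    Su x + (n + 2) * f x   ≡⟨ cong (λ t → Su x + (n + 2) * t) fx≡0 ⟩
    Su x + (n + 2) * 0     ≡⟨ cong (λ t → Su x + t) (*-zeroʳ (n + 2)) ⟩
    Su x + 0               ≡⟨ +-identityʳ (Su x) ⟩
    Su x                   ∎))))
    where open ≡-Reasoning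

  -- A codeword x with no other codeword within distance 2 would lie in a configuration where every
  -- neighbour of x is at distance 2 from exactly n/2 codewords; double counting these pairs gives
  -- 3 * S 3 f x ≡ n * (n / 2).
  near≢0 : ∀ x → f x ≡ 1 → near x ≢ 0
  near≢0 x fx≡1 near≡0 = 6∤n² (S 3 f x) (+-cancelʳ-≡ (2 * n) _ _ (begin
    6 * S 3 f x + 2 * n
      ≡⟨ eq₁ (S 3 f x) n ⟩
    2 * (n * 0 + 3 * S 3 f x) + (n * 0 + 2 * (n * 1 + 2 * 0))
      ≡⟨ cong₂ (λ s t → 2 * s + (n * 0 + 2 * t)) (sym S₂S₁) (sym S₁S₁) ⟩
    2 * (S 2 (S 1 f) x + 1 * 0) + (n * 0 + 2 * S 1 (S 1 f) x)
      ≡⟨ eq₂ (S 2 (S 1 f) x) (n * 0) (S 1 (S 1 f) x) ⟩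
    n * 0 + 2 * S 2 (S 1 f) x + 2 * S 1 (S 1 f) x
      ≡⟨ cong (_+ 2 * S 1 (S 1 f) x) (sym S₁S₁S₁) ⟩
    S 1 (S 1 (S 1 f)) x + 2 * S 1 (S 1 f) x
      ≡⟨ cong (λ t → S 1 (S 1 (S 1 f)) x + t) (sym (S-* 1 2 (S 1 f) x)) ⟩
    S 1 (S 1 (S 1 f)) x + S 1 (λ y → 2 * S 1 f y) x
      ≡⟨ sym (S-+ 1 (S 1 (S 1 f)) (λ y → 2 * S 1 f y) x) ⟩
    S 1 (λ y → S 1 (S 1 f) y + 2 * S 1 f y) x
      -- As `S 1 f x` is zero, all neighbours of `x` are off the code.
      ≡⟨ S-cong 1 x (λ y d → off-code y (n≤0⇒n≡0 (≤-trans (S-≥ 1 f x y d) (≤-reflexive S1≡0)))) ⟩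
    S 1 (const (n + 2)) x
      ≡⟨ S1-const (n + 2) x ⟩
    (n + 2) * n
      ≡⟨ eq₃ n ⟩
    n * n + 2 * n ∎))
    where
    open ≡-Reasoning
    eq₁ : ∀ s n → 6 * s + 2 * n ≡ 2 * (n * 0 + 3 * s) + (n * 0 + 2 * (n * 1 + 2 * 0))
    eq₁ = solve-∀
    eq₂ : ∀ v a t → 2 * (v + 1 * 0) + (a + 2 * t) ≡ a + 2 * v + 2 * t
    eq₂ = solve-∀
    eq₃ : ∀ n → (n + 2) * n ≡ n * n + 2 * n
    eq₃ = solve-∀
    S1≡0 : S 1 f x ≡ 0
    S1≡0 = m+n≡0⇒m≡0 (S 1 f x) near≡0
    S2≡0 : S 2 f x ≡ 0
    S2≡0 = m+n≡0⇒n≡0 (S 1 f x) near≡0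
    S₁S₁ : S 1 (S 1 f) x ≡ n * 1 + 2 * 0
    S₁S₁ = trans (S1S1f x) (cong₂ (λ s t → n * s + 2 * t) fx≡1 S2≡0)
    S₂S₁ : S 2 (S 1 f) x + 1 * 0 ≡ n * 0 + 3 * S 3 f x
    S₂S₁ = subst (λ t → S 2 (S 1 f) x + 1 * t ≡ n * t + 3 * S 3 f x) S1≡0 (S-step 1 f x)
    S₁S₁S₁ : S 1 (S 1 (S 1 f)) x ≡ n * 0 + 2 * S 2 (S 1 f) x
    S₁S₁S₁ = trans (sym (+-identityʳ _))
      (subst (λ t → S 1 (S 1 (S 1 f)) x + 0 ≡ n * t + 2 * S 2 (S 1 f) x) S1≡0 (S-step 0 (S 1 f) x))

  f≤f*near : ∀ x → f x ≤ f x * near x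
  f≤f*near x with ≤1-cases (f≤1 x)
  ... | inj₁ fx≡0 = ≤-trans (≤-reflexive fx≡0) z≤n
  ... | inj₂ fx≡1 = begin
    f x           ≡⟨ sym (*-identityʳ (f x)) ⟩
    f x * 1       ≤⟨ *-monoʳ-≤ (f x) (n≢0⇒n>0 (near≢0 x fx≡1)) ⟩
    f x * near x  ∎
    where open ≤-Reasoning

  f²≡f : ∀ x → f x * f x ≡ f x
  f²≡f x with f x | f≤1 x
  ... | 0 | _ = refl
  ... | 1 | _ = refl
  ... | suc (suc _) | s≤s ()

  -- `Q` is computed twice: the second equality of `tight` gives `(n + 3) F`, and expanding `Su` on
  -- the code gives `(n + 1) F + 2 P`.
  ∑near : ∑ (λ x → f x * near x) ≡ F
  ∑near = *-cancelˡ-≡ P F 2 (+-cancelˡ-≡ (suc n * F + 2 * (n * F)) _ _ (begin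
    suc n * F + 2 * (n * F) + 2 * P
      ≡⟨ eq₁ (suc n * F) (2 * (n * F)) (2 * P) ⟩
    suc n * F + 2 * P + 2 * (n * F)
      ≡⟨ cong (_+ 2 * (n * F)) (sym Q≡) ⟩
    Q + 2 * (n * F)
      ≡⟨ sym ∑u²+2 ⟩
    ∑ (λ x → u x * u x + 2)
      ≡⟨ sym (∑-cong (proj₂ ∘ tight)) ⟩
    ∑ (λ x → 3 * u x)
      ≡⟨ ∑3u ⟩
    3 * (suc n * F)
      ≡⟨ eq₂ n F ⟩
    suc n * F + 2 * (n * F) + 2 * F ∎))
    where
    open ≡-Reasoning
    P : ℕ
    P = ∑ (λ x → f x * near x)
    eq₁ : ∀ a b c → a + b + c ≡ a + c + b
    eq₁ = solve-∀
    eq₂ : ∀ n F → 3 * (suc n * F) ≡ suc n * F + 2 * (n * F) + 2 * F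
    eq₂ = solve-∀
    eq₃ : ∀ m φ p → (m * φ + 2 * p) * φ ≡ m * (φ * φ) + 2 * (φ * p)
    eq₃ = solve-∀
    Q≡ : Q ≡ suc n * F + 2 * P
    Q≡ = begin
      Q
        ≡⟨ sym ∑Su*f ⟩
      ∑ (λ x → Su x * f x)
        ≡⟨ ∑-cong (λ x → trans (cong (_* f x) (Su-expand x)) (trans (eq₃ (suc n) (f x) (near x))
             (cong (λ t → suc n * t + 2 * (f x * near x)) (f²≡f x)))) ⟩
      ∑ (λ x → suc n * f x + 2 * (f x * near x))
        ≡⟨ ∑-+ (λ x → suc n * f x) (λ x → 2 * (f x * near x)) ⟩
      ∑ (λ x → suc n * f x) + ∑ (λ x → 2 * (f x * near x))
        ≡⟨ cong₂ _+_ (∑-* (suc n) f) (∑-* 2 (λ x → f x * near x)) ⟩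
      suc n * F + 2 * P ∎

  -- Existence and uniqueness of the partner: every codeword has `near` at least 1, and by `∑near`
  -- the average is 1.
  near≡1 : ∀ x → f x ≡ 1 → near x ≡ 1
  near≡1 x fx≡1 = begin
    near x        ≡⟨ sym (*-identityˡ (near x)) ⟩
    1 * near x    ≡⟨ cong (_* near x) (sym fx≡1) ⟩
    f x * near x  ≡⟨ sym (∑-mono-≡ f≤f*near (≤-reflexive ∑near) x) ⟩
    f x           ≡⟨ fx≡1 ⟩
    1             ∎
    where open ≡-Reasoning

  S1S1f+2S1f : ∀ x → S 1 (S 1 f) x + 2 * S 1 f x ≡ n + 2
  S1S1f+2S1f x with ≤1-cases (f≤1 x)
  ... | inj₁ fx≡0 = off-code x fx≡0
  ... | inj₂ fx≡1 = spectral (n + 2) x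
    (cong₂ (λ s t → s + 2 * t) (trans (cong (n *_) fx≡1) (*-identityʳ n)) (near≡1 x fx≡1))

-- The weight recurrence

-- The hypothesis expresses the sphere sum of `S 1 g` through that of `g`, and `S-step` then yields
-- the sum of `g` two radii further out. The induction therefore carries two consecutive radii; the
-- hypothesis at 0 supplies the second initial value.
S-unique : ∀ m (g h : Word n → ℕ) x → g x ≡ h x →
  (∀ i → S i (S 1 g) x + m * S i g x ≡ S i (S 1 h) x + m * S i h x) →
  ∀ i → S i g x ≡ S i h x
S-unique {n} m g h x g≡h e = proj₁ ∘ go
  where
  next : ∀ i → S i g x ≡ S i h x → S i (S 1 g) x ≡ S i (S 1 h) x
  next i eq = +-cancelʳ-≡ (m * S i g x) _ _ (trans (e i) (cong (λ t → S i (S 1 h) x + m * t) (sym eq)))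
  go : ∀ i → S i g x ≡ S i h x × S (suc i) g x ≡ S (suc i) h x
  go zero    = g≡h , next 0 g≡h
  go (suc i) with go i
  ... | p , q = q , *-cancelˡ-≡ _ _ (2 + i) (+-cancelˡ-≡ (n * S i g x) _ _ (begin
    n * S i g x + (2 + i) * S (2 + i) g x    ≡⟨ sym (S-step i g x) ⟩
    S (1 + i) (S 1 g) x + i * S i g x        ≡⟨ cong₂ (λ s t → s + i * t) (next (1 + i) q) p ⟩
    S (1 + i) (S 1 h) x + i * S i h x        ≡⟨ S-step i h x ⟩
    n * S i h x + (2 + i) * S (2 + i) h x    ≡⟨ cong (λ t → n * t + (2 + i) * S (2 + i) h x) (sym p) ⟩
    n * S i g x + (2 + i) * S (2 + i) h x    ∎))
    where open ≡-Reasoning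

S-const : ∀ k m (x : Word n) → S k (const m) x ≡ m * (n C k)
S-const k m x = trans (S-cong k x λ _ _ → sym (*-identityʳ m))
  (trans (S-* k m (const 1) x) (cong (m *_) (S-1 k x)))

-- `S-step` for the constant function 1, whose neighbour sums are all `n`.
C-step : ∀ n i → n * (n C (1 + i)) + i * (n C i) ≡ n * (n C i) + (2 + i) * (n C (2 + i))
C-step n i = begin
  n * (n C (1 + i)) + i * (n C i)
    ≡⟨ cong₂ (λ s t → s + i * t) (sym S₁) (sym (S-1 i x)) ⟩
  S (1 + i) (S 1 (const 1)) x + i * S i (const 1) x
    ≡⟨ S-step i (const 1) x ⟩
  n * S i (const 1) x + (2 + i) * S (2 + i) (const 1) x
    ≡⟨ cong₂ (λ s t → n * s + (2 + i) * t) (S-1 i x) (S-1 (2 + i) x) ⟩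
  n * (n C i) + (2 + i) * (n C (2 + i)) ∎
  where
  open ≡-Reasoning
  x : Word n
  x = replicate n false
  S₁ : S (1 + i) (S 1 (const 1)) x ≡ n * (n C (1 + i))
  S₁ = trans (S-cong (1 + i) x λ y _ → trans (S1-const 1 y) (*-identityˡ n)) (S-const (1 + i) n x)

-- The absorption identity `(k + 1) C(n, k + 1) = (n - k) C(n, k)` without subtraction.
C-absorb : ∀ n k → k * (n C k) + suc k * (n C suc k) ≡ n * (n C k)
C-absorb zero    zero    = refl
C-absorb zero    (suc k) = cong₂ _+_ (*-zeroʳ k) (*-zeroʳ k)
C-absorb (suc n) zero    = trans (+-identityʳ _) (trans (nC1≡n (suc n)) (sym (*-identityʳ (suc n))))
C-absorb (suc n) (suc k)
  rewrite sym (nCk+nC[k+1]≡[n+1]C[k+1] n k) | sym (nCk+nC[k+1]≡[n+1]C[k+1] n (suc k)) = begin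
  suc k * (a + b) + (2 + k) * (b + c)
    ≡⟨ lhs k a b c ⟩
  (k * a + suc k * b) + (suc k * b + (2 + k) * c) + (a + b)
    ≡⟨ cong₂ (λ s t → s + t + (a + b)) (C-absorb n k) (C-absorb n (suc k)) ⟩
  n * a + n * b + (a + b)
    ≡⟨ rhs n a b ⟩
  suc n * (a + b) ∎
  where
  open ≡-Reasoning
  a b c : ℕ
  a = n C k
  b = n C suc k
  c = n C suc (suc k)
  lhs : ∀ k a b c → suc k * (a + b) + (2 + k) * (b + c)
      ≡ (k * a + suc k * b) + (suc k * b + (2 + k) * c) + (a + b)
  lhs = solve-∀
  rhs : ∀ n a b → n * a + n * b + (a + b) ≡ suc n * (a + b)
  rhs = solve-∀

-- Signed binomials and the deviation from `n C i`

sgn : ℕ → ℤ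
sgn k = -1ℤ ℤ.^ k

sgn-even : ∀ k → sgn (k * 2) ≡ 1ℤ
sgn-even zero    = refl
sgn-even (suc k) = cong (λ t → -1ℤ ℤ.* (-1ℤ ℤ.* t)) (sgn-even k)

-- The coefficients of (1 - z²)^h
D : ℕ → ℕ → ℤ
D h k = sgn k ℤ.* + (h C k)

-- The homogeneous recurrence at `i = 2j` with `n = 2h`; after division by 2 it is absorption for
-- `h C j`. The `+ 0` matches the index `j * 2 + p` of `solve-recursion`.
D-step : ∀ h s j → + (j * 2 + 0) ℤ.* (s ℤ.* D h j)
  ≡ + (2 * h) ℤ.* (s ℤ.* D h j) ℤ.+ + (2 + (j * 2 + 0)) ℤ.* (s ℤ.* D h (suc j))
D-step h s j = begin
  + (j * 2 + 0) ℤ.* (s ℤ.* (p ℤ.* c))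
    ≡⟨ cong (ℤ._* (s ℤ.* (p ℤ.* c))) 2j ⟩
  K ℤ.* + 2 ℤ.* (s ℤ.* (p ℤ.* c))
    ≡⟨ lhs K s p c c′ ⟩
  + 2 ℤ.* s ℤ.* p ℤ.* (K ℤ.* c ℤ.+ (1ℤ ℤ.+ K) ℤ.* c′) ℤ.- + 2 ℤ.* s ℤ.* p ℤ.* (1ℤ ℤ.+ K) ℤ.* c′
    ≡⟨ cong (λ t → + 2 ℤ.* s ℤ.* p ℤ.* t ℤ.- + 2 ℤ.* s ℤ.* p ℤ.* (1ℤ ℤ.+ K) ℤ.* c′) absorb ⟩
  + 2 ℤ.* s ℤ.* p ℤ.* (+ h ℤ.* c) ℤ.- + 2 ℤ.* s ℤ.* p ℤ.* (1ℤ ℤ.+ K) ℤ.* c′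
    ≡⟨ rhs K (+ h) s p c c′ ⟩
  + 2 ℤ.* + h ℤ.* (s ℤ.* (p ℤ.* c)) ℤ.+ (+ 2 ℤ.+ K ℤ.* + 2) ℤ.* (s ℤ.* (-1ℤ ℤ.* p ℤ.* c′))
    ≡⟨ sym (cong₂ (λ t u → t ℤ.* (s ℤ.* (p ℤ.* c)) ℤ.+ (+ 2 ℤ.+ u) ℤ.* (s ℤ.* (-1ℤ ℤ.* p ℤ.* c′)))
         (ℤ.pos-* 2 h) 2j) ⟩
  + (2 * h) ℤ.* (s ℤ.* D h j) ℤ.+ + (2 + (j * 2 + 0)) ℤ.* (s ℤ.* D h (suc j)) ∎
  where
  open ≡-Reasoning
  K p c c′ : ℤ
  K  = + j
  p  = sgn j
  c  = + (h C j)
  c′ = + (h C suc j)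
  2j : + (j * 2 + 0) ≡ K ℤ.* + 2
  2j = trans (cong +_ (+-identityʳ (j * 2))) (ℤ.pos-* j 2)
  absorb : K ℤ.* c ℤ.+ (1ℤ ℤ.+ K) ℤ.* c′ ≡ + h ℤ.* c
  absorb = trans (sym (cong₂ ℤ._+_ (ℤ.pos-* j (h C j)) (ℤ.pos-* (suc j) (h C suc j))))
    (trans (cong +_ (C-absorb h j)) (ℤ.pos-* h (h C j)))
  lhs : ∀ K s p c c′ → K ℤ.* + 2 ℤ.* (s ℤ.* (p ℤ.* c))
    ≡ + 2 ℤ.* s ℤ.* p ℤ.* (K ℤ.* c ℤ.+ (1ℤ ℤ.+ K) ℤ.* c′) ℤ.- + 2 ℤ.* s ℤ.* p ℤ.* (1ℤ ℤ.+ K) ℤ.* c′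
  lhs = ℤ-Solver.solve-∀
  rhs : ∀ K h s p c c′ → + 2 ℤ.* s ℤ.* p ℤ.* (h ℤ.* c) ℤ.- + 2 ℤ.* s ℤ.* p ℤ.* (1ℤ ℤ.+ K) ℤ.* c′
    ≡ + 2 ℤ.* h ℤ.* (s ℤ.* (p ℤ.* c)) ℤ.+ (+ 2 ℤ.+ K ℤ.* + 2) ℤ.* (s ℤ.* (-1ℤ ℤ.* p ℤ.* c′))
  rhs = ℤ-Solver.solve-∀

module _ (n : ℕ) (a : ℕ → ℕ)
  (a-step : ∀ i → n C (1 + i) + i * a i ≡ n * a i + (2 + i) * a (2 + i)) where

  -- By `C-step`, the binomials solve the recurrence for `n * a i`, so the deviation `e` need only
  -- solve the homogeneous one. Indices advance by two, so each parity `p` has its own initial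
  -- value.
  solve-recursion : ∀ p (e : ℕ → ℤ) →
    (∀ j → + (j * 2 + p) ℤ.* e j ≡ + n ℤ.* e j ℤ.+ + (2 + (j * 2 + p)) ℤ.* e (suc j)) →
    + n ℤ.* + a p ≡ + (n C p) ℤ.+ e 0 →
    ∀ j → + n ℤ.* + a (j * 2 + p) ≡ + (n C (j * 2 + p)) ℤ.+ e j
  solve-recursion p e e-step base zero    = base
  solve-recursion p e e-step base (suc j) = ℤ.*-cancelˡ-≡ (+ (2 + i)) _ _ (begin
    + (2 + i) ℤ.* (+ n ℤ.* + a (2 + i))
      ≡⟨ lhs (+ n) (+ i) (+ a i) (+ a (2 + i)) ⟩
    + n ℤ.* (+ n ℤ.* + a i ℤ.+ + (2 + i) ℤ.* + a (2 + i)) ℤ.- + n ℤ.* (+ n ℤ.* + a i)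
      ≡⟨ cong₂ (λ s t → + n ℤ.* s ℤ.- + n ℤ.* t) (sym step) ih ⟩
    + n ℤ.* (+ (n C (1 + i)) ℤ.+ + i ℤ.* + a i) ℤ.- + n ℤ.* (+ (n C i) ℤ.+ e j)
      ≡⟨ mid₁ (+ n) (+ i) (+ a i) (+ (n C (1 + i))) (+ (n C i)) (e j) ⟩
    + n ℤ.* + (n C (1 + i)) ℤ.+ + i ℤ.* (+ n ℤ.* + a i) ℤ.- + n ℤ.* (+ (n C i) ℤ.+ e j)
      ≡⟨ cong (λ t → + n ℤ.* + (n C (1 + i)) ℤ.+ + i ℤ.* t ℤ.- + n ℤ.* (+ (n C i) ℤ.+ e j)) ih ⟩
    + n ℤ.* + (n C (1 + i)) ℤ.+ + i ℤ.* (+ (n C i) ℤ.+ e j) ℤ.- + n ℤ.* (+ (n C i) ℤ.+ e j)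
      ≡⟨ mid₂ (+ n) (+ i) (+ (n C (1 + i))) (+ (n C i)) (e j) ⟩
    (+ n ℤ.* + (n C (1 + i)) ℤ.+ + i ℤ.* + (n C i)) ℤ.+ + i ℤ.* e j ℤ.- + n ℤ.* (+ (n C i) ℤ.+ e j)
      ≡⟨ cong₂ (λ s t → s ℤ.+ t ℤ.- + n ℤ.* (+ (n C i) ℤ.+ e j)) binomial (e-step j) ⟩
    (+ n ℤ.* + (n C i) ℤ.+ + (2 + i) ℤ.* + (n C (2 + i))) ℤ.+ (+ n ℤ.* e j ℤ.+ + (2 + i) ℤ.* e (suc j))
      ℤ.- + n ℤ.* (+ (n C i) ℤ.+ e j)
      ≡⟨ rhs (+ n) (+ (2 + i)) (+ (n C i)) (+ (n C (2 + i))) (e j) (e (suc j)) ⟩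
    + (2 + i) ℤ.* (+ (n C (2 + i)) ℤ.+ e (suc j)) ∎)
    where
    open ≡-Reasoning
    i : ℕ
    i = j * 2 + p
    ih : + n ℤ.* + a i ≡ + (n C i) ℤ.+ e j
    ih = solve-recursion p e e-step base j
    pos-*+* : ∀ k l m o → + (k * l + m * o) ≡ + k ℤ.* + l ℤ.+ + m ℤ.* + o
    pos-*+* k l m o = cong₂ ℤ._+_ (ℤ.pos-* k l) (ℤ.pos-* m o)
    step : + (n C (1 + i)) ℤ.+ + i ℤ.* + a i ≡ + n ℤ.* + a i ℤ.+ + (2 + i) ℤ.* + a (2 + i)
    step = trans (cong (ℤ._+_ (+ (n C (1 + i)))) (sym (ℤ.pos-* i (a i))))
      (trans (cong +_ (a-step i)) (pos-*+* n (a i) (2 + i) (a (2 + i))))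
    binomial : + n ℤ.* + (n C (1 + i)) ℤ.+ + i ℤ.* + (n C i)
      ≡ + n ℤ.* + (n C i) ℤ.+ + (2 + i) ℤ.* + (n C (2 + i))
    binomial = trans (sym (pos-*+* n (n C (1 + i)) i (n C i)))
      (trans (cong +_ (C-step n i)) (pos-*+* n (n C i) (2 + i) (n C (2 + i))))
    lhs : ∀ n i a a′ → (+ 2 ℤ.+ i) ℤ.* (n ℤ.* a′)
      ≡ n ℤ.* (n ℤ.* a ℤ.+ (+ 2 ℤ.+ i) ℤ.* a′) ℤ.- n ℤ.* (n ℤ.* a)
    lhs = ℤ-Solver.solve-∀
    mid₁ : ∀ n i a b c e → n ℤ.* (b ℤ.+ i ℤ.* a) ℤ.- n ℤ.* (c ℤ.+ e)
      ≡ n ℤ.* b ℤ.+ i ℤ.* (n ℤ.* a) ℤ.- n ℤ.* (c ℤ.+ e)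
    mid₁ = ℤ-Solver.solve-∀
    mid₂ : ∀ n i b c e → n ℤ.* b ℤ.+ i ℤ.* (c ℤ.+ e) ℤ.- n ℤ.* (c ℤ.+ e)
      ≡ (n ℤ.* b ℤ.+ i ℤ.* c) ℤ.+ i ℤ.* e ℤ.- n ℤ.* (c ℤ.+ e)
    mid₂ = ℤ-Solver.solve-∀
    rhs : ∀ n m c c′ e e′ → (n ℤ.* c ℤ.+ m ℤ.* c′) ℤ.+ (n ℤ.* e ℤ.+ m ℤ.* e′) ℤ.- n ℤ.* (c ℤ.+ e)
      ≡ m ℤ.* (c′ ℤ.+ e′)
    rhs = ℤ-Solver.solve-∀

-- The numbers `Δ` as signed binomials

signΔ-even : ∀ j z → signΔ (j * 2) z ≡ sgn j ℤ.* z
signΔ-even zero          z = sym (ℤ.*-identityˡ z)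
signΔ-even (suc zero)    z = sym (ℤ.-1*i≡-i z)
-- `signΔ` has period four, so `j` advances by two.
signΔ-even (suc (suc j)) z = trans (signΔ-even j z) (eq (sgn j) z)
  where
  eq : ∀ p z → p ℤ.* z ≡ -1ℤ ℤ.* (-1ℤ ℤ.* p) ℤ.* z
  eq = ℤ-Solver.solve-∀

signΔ-odd : ∀ j z → signΔ (suc (j * 2)) z ≡ - (sgn j ℤ.* z)
signΔ-odd zero          z = cong -_ (sym (ℤ.*-identityˡ z))
signΔ-odd (suc zero)    z = eq z
  where
  eq : ∀ z → z ≡ - (-1ℤ ℤ.* z)
  eq = ℤ-Solver.solve-∀
signΔ-odd (suc (suc j)) z = trans (signΔ-odd j z) (eq (sgn j) z)
  where
  eq : ∀ p z → - (p ℤ.* z) ≡ - (-1ℤ ℤ.* (-1ℤ ℤ.* p) ℤ.* z)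
  eq = ℤ-Solver.solve-∀

half-even : ∀ j → half (j * 2) ≡ j
half-even zero    = refl
half-even (suc j) = cong suc (half-even j)

half-odd : ∀ j → half (suc (j * 2)) ≡ j
half-odd zero    = refl
half-odd (suc j) = cong suc (half-odd j)

Δ-even : ∀ v j → Δ v (j * 2) ≡ sgn j ℤ.* + (v C j)
Δ-even v j = trans (cong (λ t → signΔ (j * 2) (+ (v C t))) (half-even j)) (signΔ-even j _)

Δ-odd : ∀ v j → Δ v (suc (j * 2)) ≡ - (sgn j ℤ.* + (v C j))
Δ-odd v j = trans (cong (λ t → signΔ (suc (j * 2)) (+ (v C t))) (half-odd j)) (signΔ-odd j _)

-- The generating function of `Δ` is `(1 - z)(1 - z²)^v`; adding adjacent coefficients multiplies it
-- by `1 + z`, which gives `(1 - z²)^(v + 1)`.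
Δ+Δ≡D : ∀ v j → Δ v (suc (j * 2)) ℤ.+ Δ v (suc j * 2) ≡ D (suc v) (suc j)
Δ+Δ≡D v j = begin
  Δ v (suc (j * 2)) ℤ.+ Δ v (suc j * 2)
    ≡⟨ cong₂ ℤ._+_ (Δ-odd v j) (Δ-even v (suc j)) ⟩
  - (sgn j ℤ.* + (v C j)) ℤ.+ sgn (suc j) ℤ.* + (v C suc j)
    ≡⟨ eq (sgn j) (+ (v C j)) (+ (v C suc j)) ⟩
  sgn (suc j) ℤ.* (+ (v C j + v C suc j))
    ≡⟨ cong (λ t → sgn (suc j) ℤ.* + t) (nCk+nC[k+1]≡[n+1]C[k+1] v j) ⟩
  D (suc v) (suc j) ∎
  where
  open ≡-Reasoning
  eq : ∀ p a b → - (p ℤ.* a) ℤ.+ -1ℤ ℤ.* p ℤ.* b ≡ -1ℤ ℤ.* p ℤ.* (a ℤ.+ b)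
  eq = ℤ-Solver.solve-∀

-- Passage to rational numbers

/-intro : ∀ d .{{_ : NonZero d}} a z → + d ℤ.* + a ≡ z → + a ℚ./ 1 ≡ z ℚ./ d
/-intro (suc d) a z e = fromℚᵘ-cong {mkℚᵘ (+ a) 0} {mkℚᵘ z d}
  (*≡* (trans (ℤ.*-comm (+ a) (+ suc d)) (trans e (sym (ℤ.*-identityʳ z)))))

-- Checked on unnormalised fractions, where no common factors are cancelled and addition is
-- cross-multiplication.
/-+ : ∀ p q d .{{_ : NonZero d}} → p ℚ./ d ℚ.+ q ℚ./ d ≡ (p ℤ.+ q) ℚ./ d
/-+ p q (suc d) = toℚᵘ-injective (begin-equality
  toℚᵘ (p ℚ./ suc d ℚ.+ q ℚ./ suc d)
    ≃⟨ toℚᵘ-homo-+ (p ℚ./ suc d) (q ℚ./ suc d) ⟩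
  toℚᵘ (p ℚ./ suc d) ℚᵘ.+ toℚᵘ (q ℚ./ suc d)
    ≃⟨ ℚᵘ.+-cong (toℚᵘ-fromℚᵘ (mkℚᵘ p d)) (toℚᵘ-fromℚᵘ (mkℚᵘ q d)) ⟩
  mkℚᵘ p d ℚᵘ.+ mkℚᵘ q d
    ≃⟨ *≡* (eq p q (+ suc d)) ⟩
  mkℚᵘ (p ℤ.+ q) d
    ≃⟨ ℚᵘ.≃-sym (toℚᵘ-fromℚᵘ (mkℚᵘ (p ℤ.+ q) d)) ⟩
  toℚᵘ ((p ℤ.+ q) ℚ./ suc d) ∎)
  where
  open ℚᵘ.≤-Reasoning
  eq : ∀ p q e → (p ℤ.* e ℤ.+ q ℤ.* e) ℤ.* e ≡ (p ℤ.+ q) ℤ.* (e ℤ.* e)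
  eq = ℤ-Solver.solve-∀

-- Codes of length 2^r

r<2^r : ∀ r → r < 2 ^ r
r<2^r zero    = s≤s z≤n
r<2^r (suc r) = +-mono-≤ (m^n>0 2 r) (≤-trans (r<2^r r) (m≤m+n (2 ^ r) 0))

3-prime : Prime 3
3-prime = from-yes (prime? 3)

3∤2^ : ∀ r → ¬ (3 ∣ 2 ^ r)
3∤2^ zero    3∣1 = contradiction (∣⇒≤ 3∣1) λ { (s≤s ()) }
3∤2^ (suc r) 3∣  with euclidsLemma 2 (2 ^ r) 3-prime 3∣
... | inj₁ 3∣2 = contradiction (∣⇒≤ 3∣2) λ { (s≤s (s≤s ())) }
... | inj₂ 3∣  = 3∤2^ r 3∣

6d≢2^r*2^r : ∀ r d → 6 * d ≢ 2 ^ r * 2 ^ r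
6d≢2^r*2^r r d e with euclidsLemma (2 ^ r) (2 ^ r) 3-prime (divides (2 * d) (trans (sym e) (eq d)))
  where
  eq : ∀ d → 6 * d ≡ 2 * d * 3
  eq = solve-∀
... | inj₁ 3∣ = 3∤2^ r 3∣
... | inj₂ 3∣ = 3∤2^ r 3∣

module NearlyPerfectCode {n} (𝒞 : Code n) (h : ℕ) (n≡2h : n ≡ 2 * h) (unique : Unique 𝒞)
  (size : 2 ^ n ≡ n * length 𝒞)
  (covering : ∀ x → ∃[ c ] (c ∈ 𝒞 × dist x c ≤ 1))
  (6∤n² : ∀ d → 6 * d ≢ n * n) where

  private
    f : Word n → ℕ
    f = mult 𝒞

    𝟎 : Word n
    𝟎 = replicate n false

    f∈ : ∀ {c} → c ∈ 𝒞 → f c ≡ 1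
    f∈ {c} c∈ = ≤-antisym (mult≤1 unique c) (∈⇒1≤mult c∈)

    S1-∈ : ∀ {x c} → c ∈ 𝒞 → dist x c ≡ 1 → 1 ≤ S 1 f x
    S1-∈ {x} {c} c∈ d = ≤-trans (∈⇒1≤mult c∈) (S-≥ 1 f x c d)

    cover : ∀ x → 1 ≤ f x + S 1 f x
    cover x with covering x
    ... | c , c∈ , d with dist x c in eq
    ... | 0 rewrite dist≡0⇒≡ x c eq = ≤-trans (∈⇒1≤mult c∈) (m≤m+n _ _)
    ... | 1 = ≤-trans (S1-∈ {x} c∈ eq) (m≤n+m _ _)
    ... | suc (suc _) with s≤s () ← d

    open NearlyPerfect f h n≡2h (mult≤1 unique) cover
      (trans size (cong (n *_) (sym (∑-mult 𝒞)))) 6∤n² using (near≡1; S1S1f+2S1f)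

  zeroed⇒A₀≡1 : Zeroed 𝒞 → A 0 𝒞 ≡ 1
  zeroed⇒A₀≡1 z = trans (A≡S-mult 0 𝒞) (f∈ z)

  nonzeroed⇒A₀≡0 : ¬ Zeroed 𝒞 → A 0 𝒞 ≡ 0
  nonzeroed⇒A₀≡0 z = trans (A≡S-mult 0 𝒞) (∉⇒mult≡0 𝒞 z)

  -- The zero word has only one partner, which leaves room for at most one codeword of weight one.
  zeroed⇒A₁≡1 : Zeroed 𝒞 → ∃[ c ] (c ∈ 𝒞 × weight c ≡ 1) → A 1 𝒞 ≡ 1
  zeroed⇒A₁≡1 z (c , c∈ , w) = trans (A≡S-mult 1 𝒞) (≤-antisym
    (≤-trans (m≤m+n _ _) (≤-reflexive (near≡1 𝟎 (f∈ z))))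
    (S1-∈ {𝟎} c∈ (trans (dist-zero c) w)))

  zeroed-A⇒weight-one : Zeroed 𝒞 → TypeA 𝒞 → ∃[ c ] (c ∈ 𝒞 × weight c ≡ 1)
  zeroed-A⇒weight-one z tA with tA 𝟎 z
  ... | c , c∈ , d = c , c∈ , trans (sym (dist-zero c)) d

  -- A codeword c of weight one has its partner at distance 1, hence no codeword at distance 2; any
  -- other codeword of weight one would be such a codeword.
  nonzeroed-A⇒A₁≡1 : ¬ Zeroed 𝒞 → TypeA 𝒞 → A 1 𝒞 ≡ 1
  nonzeroed-A⇒A₁≡1 z tA with covering 𝟎
  ... | c , c∈ , d with dist 𝟎 c in eq
  ... | 0 = contradiction (subst (_∈ 𝒞) (sym (dist≡0⇒≡ 𝟎 c eq)) c∈) z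
  ... | suc (suc _) with s≤s () ← d
  ... | 1 with tA c c∈
  ... | c′ , c′∈ , d′ = trans (A≡S-mult 1 𝒞) (≤-antisym
    (≤-trans (S1≤S0+S2 f 𝟎 c eq) (≤-reflexive (cong₂ _+_ (f∈ c∈) S2≡0)))
    (S1-∈ {𝟎} c∈ eq))
    where
    S2≡0 : S 2 f c ≡ 0
    S2≡0 = n≤0⇒n≡0 (+-cancelˡ-≤ 1 _ _
      (≤-trans (+-monoˡ-≤ (S 2 f c) (S1-∈ {c} c′∈ d′)) (≤-reflexive (near≡1 c (f∈ c∈)))))

  module _ (A₁≡1 : A 1 𝒞 ≡ 1) where

    private
      -- The constant 1 satisfies the same equation `S 1 g + 2 g = n + 2` as `S 1 f`, and the two
      -- agree at the zero word because `A 1` is 1.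
      S-S1 : ∀ i → S i (S 1 f) 𝟎 ≡ n C i
      S-S1 i = trans (S-unique 2 (S 1 f) (const 1) 𝟎 (trans (sym (A≡S-mult 1 𝒞)) A₁≡1) same i) (S-1 i 𝟎)
        where
        both : ∀ g → (∀ x → S 1 g x + 2 * g x ≡ n + 2) → ∀ i → S i (S 1 g) 𝟎 + 2 * S i g 𝟎 ≡ S i (const (n + 2)) 𝟎
        both g e i = trans (cong (λ t → S i (S 1 g) 𝟎 + t) (sym (S-* i 2 g 𝟎)))
          (trans (sym (S-+ i (S 1 g) (λ y → 2 * g y) 𝟎)) (S-cong i 𝟎 λ y _ → e y))
        same : ∀ i → S i (S 1 (S 1 f)) 𝟎 + 2 * S i (S 1 f) 𝟎 ≡ S i (S 1 (const 1)) 𝟎 + 2 * S i (const 1) 𝟎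
        same i = trans (both (S 1 f) S1S1f+2S1f i) (sym (both (const 1)
          (λ x → cong (_+ 2) (trans (S1-const 1 x) (*-identityˡ n))) i))

      A-step : ∀ i → n C (1 + i) + i * A i 𝒞 ≡ n * A i 𝒞 + (2 + i) * A (2 + i) 𝒞
      A-step i = begin
        n C (1 + i) + i * A i 𝒞
          ≡⟨ cong₂ (λ s t → s + i * t) (sym (S-S1 (1 + i))) (A≡S-mult i 𝒞) ⟩
        S (1 + i) (S 1 f) 𝟎 + i * S i f 𝟎
          ≡⟨ S-step i f 𝟎 ⟩
        n * S i f 𝟎 + (2 + i) * S (2 + i) f 𝟎
          ≡⟨ sym (cong₂ (λ s t → n * s + (2 + i) * t) (A≡S-mult i 𝒞) (A≡S-mult (2 + i) 𝒞)) ⟩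
        n * A i 𝒞 + (2 + i) * A (2 + i) 𝒞 ∎
        where open ≡-Reasoning

    -- The deviation starts at `n * 1 - n C 1 = 0` and so stays zero.
    odd-weights : ∀ j → + n ℤ.* + A (j * 2 + 1) 𝒞 ≡ + (n C (j * 2 + 1))
    odd-weights j = trans (solve-recursion n (λ i → A i 𝒞) A-step 1 (const 0ℤ) zeros base j) (ℤ.+-identityʳ _)
      where
      zeros : ∀ j → + (j * 2 + 1) ℤ.* 0ℤ ≡ + n ℤ.* 0ℤ ℤ.+ + (2 + (j * 2 + 1)) ℤ.* 0ℤ
      zeros j = trans (ℤ.*-zeroʳ (+ (j * 2 + 1)))
        (sym (cong₂ ℤ._+_ (ℤ.*-zeroʳ (+ n)) (ℤ.*-zeroʳ (+ (2 + (j * 2 + 1))))))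
      base : + n ℤ.* + A 1 𝒞 ≡ + (n C 1) ℤ.+ 0ℤ
      base = trans (cong (λ t → + n ℤ.* + t) A₁≡1) (trans (ℤ.*-identityʳ (+ n))
        (trans (cong +_ (sym (nC1≡n n))) (sym (ℤ.+-identityʳ (+ (n C 1))))))

    even-weights : ∀ s → + n ℤ.* + A 0 𝒞 ≡ 1ℤ ℤ.+ s →
      ∀ j → + n ℤ.* + A (j * 2) 𝒞 ≡ + (n C (j * 2)) ℤ.+ s ℤ.* D h j
    even-weights s nA₀≡1+s j =
      subst (λ i → + n ℤ.* + A i 𝒞 ≡ + (n C i) ℤ.+ s ℤ.* D h j) (+-identityʳ (j * 2))
        (solve-recursion n (λ i → A i 𝒞) A-step 0 (λ j → s ℤ.* D h j) step base j)
      where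
      step : ∀ j → + (j * 2 + 0) ℤ.* (s ℤ.* D h j)
        ≡ + n ℤ.* (s ℤ.* D h j) ℤ.+ + (2 + (j * 2 + 0)) ℤ.* (s ℤ.* D h (suc j))
      step = subst (λ m → ∀ j → + (j * 2 + 0) ℤ.* (s ℤ.* D h j)
        ≡ + m ℤ.* (s ℤ.* D h j) ℤ.+ + (2 + (j * 2 + 0)) ℤ.* (s ℤ.* D h (suc j))) (sym n≡2h) (D-step h s)
      base : + n ℤ.* + A 0 𝒞 ≡ + (n C 0) ℤ.+ s ℤ.* D h 0
      base = trans nA₀≡1+s (cong (λ t → 1ℤ ℤ.+ t) (sym (ℤ.*-identityʳ s)))

    -- At weight `n` both `n C n` and `D h h` are 1, the latter because `h` is even; the deviation
    -- is thus the same as at weight 0.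
    top-weight : .{{_ : NonZero n}} → ∀ m → h ≡ m * 2 → A n 𝒞 ≡ A 0 𝒞
    top-weight m h≡m*2 = ℤ.+-injective (ℤ.*-cancelˡ-≡ (+ n) (+ A n 𝒞) (+ A 0 𝒞) (begin
      + n ℤ.* + A n 𝒞                ≡⟨ cong (λ i → + n ℤ.* + A i 𝒞) n≡h*2 ⟩
      + n ℤ.* + A (h * 2) 𝒞          ≡⟨ even-weights s (shift nA₀) h ⟩
      + (n C (h * 2)) ℤ.+ s ℤ.* D h h  ≡⟨ cong₂ (λ t w → + t ℤ.+ s ℤ.* w) Cn Dh ⟩
      1ℤ ℤ.+ s ℤ.* 1ℤ                ≡⟨ unshift nA₀ ⟩
      nA₀                            ∎))
      where
      open ≡-Reasoning
      nA₀ s : ℤ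
      nA₀ = + n ℤ.* + A 0 𝒞
      s = nA₀ ℤ.- 1ℤ
      n≡h*2 : n ≡ h * 2
      n≡h*2 = trans n≡2h (*-comm 2 h)
      Cn : n C (h * 2) ≡ 1
      Cn = trans (cong (n C_) (sym n≡h*2)) (nCn≡1 n)
      Dh : D h h ≡ 1ℤ
      Dh = cong₂ (λ t w → t ℤ.* + w) (trans (cong sgn h≡m*2) (sgn-even m)) (nCn≡1 h)
      shift : ∀ z → z ≡ 1ℤ ℤ.+ (z ℤ.- 1ℤ)
      shift = ℤ-Solver.solve-∀
      unshift : ∀ z → 1ℤ ℤ.+ (z ℤ.- 1ℤ) ℤ.* 1ℤ ≡ z
      unshift = ℤ-Solver.solve-∀

-- With s = n A₀ - 1, the pairs (α, s = n - 1) and (β, s = -1) are treated at once.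
module Formulas (r : ℕ) where

  private
    N : ℕ
    N = 2 ^ r

    instance
      2^r≢0 : NonZero (2 ^ r)
      2^r≢0 = m^n≢0 2 r

    1≤N : 1 ≤ N
    1≤N = m^n>0 2 r

    half-n : ℕ
    half-n = 2 ^ (r ∸ 1)

    half-n≡1+ν : half-n ≡ suc (ν r)
    half-n≡1+ν = sym (m+[n∸m]≡n (m^n>0 2 (r ∸ 1)))

    Δ+Δ : ∀ j → Δ (ν r) (suc (j * 2)) ℤ.+ Δ (ν r) (suc j * 2) ≡ D half-n (suc j)
    Δ+Δ j = trans (Δ+Δ≡D (ν r) j) (cong (λ t → D t (suc j)) (sym half-n≡1+ν))

    pascal : ∀ i → + ((N ∸ 1) C i) ℤ.+ + ((N ∸ 1) C suc i) ≡ + (N C suc i)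
    pascal i = cong +_ (trans (nCk+nC[k+1]≡[n+1]C[k+1] (N ∸ 1) i) (cong (_C suc i) (m+[n∸m]≡n 1≤N)))

  module _ (a : ℕ → ℕ) (s : ℤ) (even : ∀ j → + N ℤ.* + a (j * 2) ≡ + (N C (j * 2)) ℤ.+ s ℤ.* D half-n j) where

    closed : ∀ j → + a (suc j * 2) ℚ./ 1
      ≡ (+ (N C (suc j * 2)) ℤ.+ s ℤ.* (Δ (ν r) (suc (j * 2)) ℤ.+ Δ (ν r) (suc j * 2))) /2^ r
    closed j = /-intro (2 ^ r) (a (suc j * 2)) _ (trans (even (suc j))
      (cong (λ t → + (N C (suc j * 2)) ℤ.+ s ℤ.* t) (sym (Δ+Δ j))))

    -- Pascal's rule splits `N C i` between the two numerators.
    two-term : ∀ j → + a (suc j * 2) ℚ./ 1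
      ≡ (+ ((N ∸ 1) C (suc j * 2)) ℤ.+ s ℤ.* Δ (ν r) (suc j * 2)) /2^ r
        ℚ.+ (+ ((N ∸ 1) C suc (j * 2)) ℤ.+ s ℤ.* Δ (ν r) (suc (j * 2))) /2^ r
    two-term j = trans (closed j) (trans (cong (_/2^ r) (begin
      + (N C (suc j * 2)) ℤ.+ s ℤ.* (Δ′ ℤ.+ Δ″)
        ≡⟨ cong (λ t → t ℤ.+ s ℤ.* (Δ′ ℤ.+ Δ″)) (sym (pascal (suc (j * 2)))) ⟩
      + ((N ∸ 1) C suc (j * 2)) ℤ.+ + ((N ∸ 1) C (suc j * 2)) ℤ.+ s ℤ.* (Δ′ ℤ.+ Δ″)
        ≡⟨ eq s (+ ((N ∸ 1) C suc (j * 2))) (+ ((N ∸ 1) C (suc j * 2))) Δ′ Δ″ ⟩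
      (+ ((N ∸ 1) C (suc j * 2)) ℤ.+ s ℤ.* Δ″) ℤ.+ (+ ((N ∸ 1) C suc (j * 2)) ℤ.+ s ℤ.* Δ′) ∎))
      (sym (/-+ (+ ((N ∸ 1) C (suc j * 2)) ℤ.+ s ℤ.* Δ″) (+ ((N ∸ 1) C suc (j * 2)) ℤ.+ s ℤ.* Δ′) (2 ^ r))))
      where
      open ≡-Reasoning
      Δ′ Δ″ : ℤ
      Δ′ = Δ (ν r) (suc (j * 2))
      Δ″ = Δ (ν r) (suc j * 2)
      eq : ∀ s a b d e → a ℤ.+ b ℤ.+ s ℤ.* (d ℤ.+ e) ≡ (b ℤ.+ s ℤ.* e) ℤ.+ (a ℤ.+ s ℤ.* d)
      eq = ℤ-Solver.solve-∀

theorem4 : (r : ℕ) → 2 ≤ r → (𝒞 : Code (2 ^ r)) → NP1CC r 𝒞 →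
    ((Zeroed 𝒞 × (TypeA 𝒞 ⊎ (TypeC 𝒞 × ∃[ c ] (c ∈ 𝒞 × weight c ≡ 1)))) →
    (A 0 𝒞 ≡ 1 × A (2 ^ r) 𝒞 ≡ 1 ×
    (∀ k → 1 ≤ k → 2 * k ≤ 2 ^ r ∸ 2 →
    ((+ A (2 * k) 𝒞) ℚ./ 1 ≡ α r (2 * k) ℚ.+ α r (2 * k ∸ 1)) ×
    ((+ A (2 * k) 𝒞) ℚ./ 1 ≡
    ((+ ((2 ^ r) C (2 * k))) ℤ.+ (+ (2 ^ r ∸ 1)) ℤ.*
    (Δ (ν r) (2 * k ∸ 1) ℤ.+ Δ (ν r) (2 * k))) /2^ r)) ×
    (∀ k → 2 * k + 1 ≤ 2 ^ r ∸ 1 →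
    (+ A (2 * k + 1) 𝒞) ℚ./ 1 ≡ (+ ((2 ^ r) C (2 * k + 1))) /2^ r))) ×
    ((¬ Zeroed 𝒞 × (TypeA 𝒞 ⊎ ((TypeB 𝒞 ⊎ TypeC 𝒞) × A 1 𝒞 ≡ 1))) →
    (A 0 𝒞 ≡ 0 × A (2 ^ r) 𝒞 ≡ 0 ×
    (∀ k → 1 ≤ k → 2 * k ≤ 2 ^ r ∸ 2 →
    ((+ A (2 * k) 𝒞) ℚ./ 1 ≡ β r (2 * k) ℚ.+ β r (2 * k ∸ 1)) ×
    ((+ A (2 * k) 𝒞) ℚ./ 1 ≡
    ((+ ((2 ^ r) C (2 * k))) ℤ.-
    (Δ (ν r) (2 * k ∸ 1) ℤ.+ Δ (ν r) (2 * k))) /2^ r)) ×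
    (∀ k → 2 * k + 1 ≤ 2 ^ r ∸ 1 →
    (+ A (2 * k + 1) 𝒞) ℚ./ 1 ≡ (+ ((2 ^ r) C (2 * k + 1))) /2^ r)))
theorem4 (suc zero) (s≤s ())
theorem4 r@(suc (suc r′)) 2≤r 𝒞 (unique , |𝒞| , covering) = zeroed , nonzeroed
  where
  N h : ℕ
  N = 2 ^ r
  h = 2 ^ suc r′

  instance
    n≢0 : NonZero N
    n≢0 = m^n≢0 2 r

  size : 2 ^ N ≡ N * length 𝒞
  size = begin
    -- Here `r < 2 ^ r` ensures that the truncated subtraction is exact.
    2 ^ N                 ≡⟨ cong (2 ^_) (sym (m+[n∸m]≡n (<⇒≤ (r<2^r r)))) ⟩
    2 ^ (r + (N ∸ r))     ≡⟨ ^-distribˡ-+-* 2 r (N ∸ r) ⟩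
    N * 2 ^ (N ∸ r)       ≡⟨ cong (N *_) (sym |𝒞|) ⟩
    N * length 𝒞          ∎
    where open ≡-Reasoning

  open NearlyPerfectCode 𝒞 h refl unique size covering (6d≢2^r*2^r r)
  open Formulas r

  top : A 1 𝒞 ≡ 1 → A N 𝒞 ≡ A 0 𝒞
  -- As `r` is at least 2, `h` is twice `2 ^ r′`, hence even.
  top A₁ = top-weight A₁ (2 ^ r′) (*-comm 2 (2 ^ r′))

  odd : A 1 𝒞 ≡ 1 → ∀ k → + A (2 * k + 1) 𝒞 ℚ./ 1 ≡ (+ (N C (2 * k + 1))) /2^ r
  odd A₁ k rewrite *-comm 2 k = /-intro N (A (k * 2 + 1) 𝒞) _ (odd-weights A₁ k)

  zeroed : _
  zeroed (z , type) = A₀ , trans (top A₁) A₀ , even , λ k _ → odd A₁ k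
    where
    A₀ : A 0 𝒞 ≡ 1
    A₀ = zeroed⇒A₀≡1 z
    A₁ : A 1 𝒞 ≡ 1
    A₁ = zeroed⇒A₁≡1 z (weight-one type)
      where
      weight-one : _ ⊎ _ → _
      weight-one (inj₁ tA)      = zeroed-A⇒weight-one z tA
      weight-one (inj₂ (_ , w)) = w
    ev : ∀ j → + N ℤ.* + A (j * 2) 𝒞 ≡ + (N C (j * 2)) ℤ.+ + (N ∸ 1) ℤ.* D h j
    ev = even-weights A₁ (+ (N ∸ 1)) (trans (cong (λ t → + N ℤ.* + t) A₀)
      (trans (ℤ.*-identityʳ (+ N)) (cong +_ (sym (m+[n∸m]≡n (m^n>0 2 r))))))
    Even : ℕ → Set
    Even i = (+ A i 𝒞 ℚ./ 1 ≡ α r i ℚ.+ α r (i ∸ 1))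
      × (+ A i 𝒞 ℚ./ 1 ≡ (+ (N C i) ℤ.+ + (N ∸ 1) ℤ.* (Δ (ν r) (i ∸ 1) ℤ.+ Δ (ν r) i)) /2^ r)
    even : ∀ k → 1 ≤ k → 2 * k ≤ N ∸ 2 → Even (2 * k)
    -- Written as `suc j * 2`, the index has a predecessor that computes to `suc (j * 2)`.
    even (suc j) _ _ = subst Even (*-comm (suc j) 2)
      (two-term (λ i → A i 𝒞) (+ (N ∸ 1)) ev j , closed (λ i → A i 𝒞) (+ (N ∸ 1)) ev j)

  nonzeroed : _
  nonzeroed (z , type) = A₀ , trans (top A₁) A₀ , even , λ k _ → odd A₁ k
    where
    A₀ : A 0 𝒞 ≡ 0
    A₀ = nonzeroed⇒A₀≡0 z
    A₁ : A 1 𝒞 ≡ 1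
    A₁ = count type
      where
      count : _ ⊎ _ → _
      count (inj₁ tA)       = nonzeroed-A⇒A₁≡1 z tA
      count (inj₂ (_ , A₁)) = A₁
    ev : ∀ j → + N ℤ.* + A (j * 2) 𝒞 ≡ + (N C (j * 2)) ℤ.+ -1ℤ ℤ.* D h j
    ev = even-weights A₁ -1ℤ (trans (cong (λ t → + N ℤ.* + t) A₀) (ℤ.*-zeroʳ (+ N)))
    Even : ℕ → Set
    Even i = (+ A i 𝒞 ℚ./ 1 ≡ β r i ℚ.+ β r (i ∸ 1))
      × (+ A i 𝒞 ℚ./ 1 ≡ (+ (N C i) ℤ.- (Δ (ν r) (i ∸ 1) ℤ.+ Δ (ν r) i)) /2^ r)
    even : ∀ k → 1 ≤ k → 2 * k ≤ N ∸ 2 → Even (2 * k)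
    even (suc j) _ _ = subst Even (*-comm (suc j) 2)
      ( trans (two-term (λ i → A i 𝒞) -1ℤ ev j) (cong₂ (λ t u → t ℚ.+ u)
          (-1*≡- (+ ((N ∸ 1) C (suc j * 2))) (Δ (ν r) (suc j * 2)))
          (-1*≡- (+ ((N ∸ 1) C suc (j * 2))) (Δ (ν r) (suc (j * 2)))))
      , trans (closed (λ i → A i 𝒞) -1ℤ ev j)
          (-1*≡- (+ (N C (suc j * 2))) (Δ (ν r) (suc (j * 2)) ℤ.+ Δ (ν r) (suc j * 2))))
      where
      -1*≡- : ∀ x y → (x ℤ.+ -1ℤ ℤ.* y) /2^ r ≡ (x ℤ.- y) /2^ r
      -1*≡- x y = cong (λ t → (x ℤ.+ t) /2^ r) (ℤ.-1*i≡-i y)
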